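{- Let $G$ be a connected claw-free graph. Then $G$ has an IPD if and only if $G$ has at least one block which is not a complete graph of odd order.
   Context: All graphs are finite and simple. A graph is claw-free if it contains no induced subgraph isomorphic to $K_{1,3}$. A block of $G$ is a maximal connected subgraph of $G$ that has no cut vertex of its own (so blocks are maximal 2-connected subgraphs, bridges $K_2$, or an isolated $K_1$). A subgraph $H$ of $G$ is induced if for all $u,v\in V(H)$, $uv\in E(H)$ iff $uv\in E(G)$. An induced path decomposition of $G$ is a set of pairwise vertex-disjoint paths covering all vertices of $G$, each of which is an induced subgraph of $G$. $G$ has an IPD if it has an induced path decomposition in which every path has order (number of vertices) at least $2$. -}

module Defs where

open import Data.Nat using (ℕ; suc; _≤_; _*_; _+_)
open import Data.Bool using (Bool; true; false)
open import Data.Fin using (Fin; toℕ)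
open import Data.Fin.Subset using (Subset; _∈_; _∉_; _⊆_; ∣_∣)
open import Data.List using (List; length; lookup; concat)
open import Data.List.Membership.Propositional using () renaming (_∈_ to _∈ₗ_)
open import Data.List.Relation.Unary.Unique.Propositional using (Unique)
open import Data.List.Relation.Unary.All using (All)
open import Data.Product using (Σ; ∃; _×_; _,_)
open import Data.Sum using (_⊎_)
open import Relation.Binary.PropositionalEquality using (_≡_; _≢_)
open import Relation.Nullary using (¬_)
open import Function.Bundles using (_⇔_)

record Graph : Set where
  field
    n      : ℕ
    adj    : Fin n → Fin n → Bool
    sym    : ∀ x y → adj x y ≡ adj y x
    irrefl : ∀ x → adj x x ≡ false

module _ (G : Graph) where
  open Graph G

  E : Fin n → Fin n → Set
  E x y = adj x y ≡ true

  ClawFree : Set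
  ClawFree = ∀ c a b d → E c a → E c b → E c d →
             a ≢ b → a ≢ d → b ≢ d →
             ¬ E a b → ¬ E a d → ¬ E b d → Data.Empty.⊥
    where import Data.Empty

  data Reach (S : Subset n) (x : Fin n) : Fin n → Set where
    here : x ∈ S → Reach S x x
    step : ∀ {y z} → Reach S x y → E y z → z ∈ S → Reach S x z

  ConnectedOn : Subset n → Set
  ConnectedOn S = (∃ λ v → v ∈ S) × (∀ x y → x ∈ S → y ∈ S → Reach S x y)

  remove : Subset n → Fin n → Subset n
  remove S v = S Data.Fin.Subset.∩ Data.Fin.Subset.∁ Data.Fin.Subset.⁅ v ⁆

  CutVertexOf : Subset n → Fin n → Set
  CutVertexOf S v = v ∈ S × ∃ λ x → ∃ λ y →
    x ∈ remove S v × y ∈ remove S v × ¬ Reach (remove S v) x y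

  NonSeparable : Subset n → Set
  NonSeparable S = ConnectedOn S × (∀ v → ¬ CutVertexOf S v)

  -- S is (the vertex set of) a block: a maximal connected subgraph without
  -- a cut vertex (blocks are necessarily induced subgraphs).
  IsBlock : Subset n → Set
  IsBlock S = NonSeparable S × (∀ T → S ⊆ T → NonSeparable T → T ⊆ S)

  CompleteOn : Subset n → Set
  CompleteOn S = ∀ x y → x ∈ S → y ∈ S → x ≢ y → E x y

  Odd : ℕ → Set
  Odd m = ∃ λ k → m ≡ suc (2 * k)

  OddComplete : Subset n → Set
  OddComplete S = CompleteOn S × Odd ∣ S ∣

  IsInducedPath : List (Fin n) → Set
  IsInducedPath p = Unique p ×
    (∀ (i j : Fin (length p)) →
       E (lookup p i) (lookup p j) ⇔ (toℕ j ≡ suc (toℕ i) ⊎ toℕ i ≡ suc (toℕ j)))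

  IsIPD : List (List (Fin n)) → Set
  IsIPD ps = All (λ p → IsInducedPath p × 2 ≤ length p) ps
           × Unique (concat ps)
           × (∀ v → v ∈ₗ concat ps)

  HasIPD : Set
  HasIPD = ∃ λ ps → IsIPD ps

  Connected : Set
  Connected = ConnectedOn Data.Fin.Subset.⊤

module Submission where

open import Defs
open import Data.Bool using (true)
import Data.Bool.Properties as Bool
open import Data.Empty using (⊥-elim)
open import Data.Fin using (Fin; zero; suc; _≟_; toℕ; inject₁)
open import Data.Fin.Patterns
open import Data.Fin.Properties using (any?; all?; toℕ-inject₁)
open import Data.Fin.Subset using (Subset; inside; outside; _∈_; _∉_; _⊆_; ∣_∣; _∩_; _∪_; ∁; ⁅_⁆; ⊤)
  renaming (⊥ to ∅)
open import Data.Fin.Subset.Properties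
open import Data.List using (List; []; _∷_; _++_; map; concat; foldl; lookup; length)
open import Data.List.Membership.DecPropositional using () renaming (_∈?_ to ∈ₗ-dec)
open import Data.List.Membership.Propositional using (find; lose) renaming (_∈_ to _∈ₗ_)
open import Data.List.Membership.Propositional.Properties
  using (∈-++⁺ʳ; ∈-++⁺ˡ; ∈-++⁻; ∈-concat⁺′; ∈-concat⁻′; ∈-lookup; ∈-map⁺)
open import Data.List.Relation.Unary.All as All using (All; []; _∷_)
import Data.List.Relation.Unary.All.Properties as All
open import Data.List.Relation.Unary.AllPairs using ([]; _∷_)
open import Data.List.Relation.Unary.Any as Any using (Any; here; there; index)
open import Data.List.Relation.Unary.Any.Properties using (lookup-index)
import Data.List.Relation.Unary.Unique.DecPropositional as DecUnique
open import Data.List.Relation.Unary.Unique.Propositional using (Unique)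
import Data.List.Relation.Unary.Unique.Propositional.Properties as Unique
open import Data.Nat using (ℕ; zero; suc; _+_; _≤_; _<_; s≤s; z≤n)
import Data.Nat.Properties as ℕ
open import Data.Product using (∃; _×_; _,_; proj₁; proj₂; swap)
open import Data.Sum using (_⊎_; inj₁; inj₂; [_,_]′)
open import Data.Vec using (_∷_; tabulate; here; there)
open import Data.Vec.Properties using (lookup⇒[]=; []=⇒lookup; lookup∘tabulate)
open import Function using (_∘_; case_of_)
open import Function.Bundles using (_⇔_; mk⇔; Equivalence)
open import Relation.Binary.PropositionalEquality
  using (_≡_; _≢_; refl; sym; trans; cong; subst; subst₂)
open import Relation.Nullary using (¬_; Dec; yes; no; does)
open import Relation.Nullary.Decidable
  using (_×-dec_; _⊎-dec_; _→-dec_; ¬?; map′; decidable-stable; dec-true; True; toWitness)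
open import Relation.Unary using (Pred; Decidable)

-- A graph all of whose blocks are complete is one in which nonadjacent neighbours of a vertex are
-- separated by that vertex.  If in addition all blocks are odd, the path edges of an induced path
-- decomposition form a matching in each block, so each block has a vertex whose path edges all
-- leave it; following such vertices one moves forever away from the start.
-- Conversely, a connected claw-free graph on at least three vertices contains an edge xy whose
-- removal leaves it connected.  By induction the rest is either tiled by edges and induced
-- three-vertex paths, or is a connected graph with odd complete blocks; the latter has a perfect
-- matching after deletion of any one vertex.  In the second case either some matching can be
-- rerouted through xy to a tiling, or x and y are twins attached to exactly one vertex or to exactly
-- one block, so that the blocks remain complete and odd.

-- Deletion of vertices from a subset

module _ {n : ℕ} where

  infixl 6 _∖_ _∖∖_

  _∖_ : Subset n → Fin n → Subset n
  S ∖ v = S ∩ ∁ ⁅ v ⁆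

  _∖∖_ : Subset n → List (Fin n) → Subset n
  _∖∖_ = foldl _∖_

  ∈∖⁺ : ∀ {S v z} → z ∈ S → z ≢ v → z ∈ S ∖ v
  ∈∖⁺ z∈S z≢v = x∈p∩q⁺ (z∈S , x∉p⇒x∈∁p (z≢v ∘ x∈⁅y⁆⇒x≡y _))

  ∈∖⇒∈ : ∀ {S v z} → z ∈ S ∖ v → z ∈ S
  ∈∖⇒∈ = proj₁ ∘ x∈p∩q⁻ _ _

  ∈∖⇒≢ : ∀ {S v z} → z ∈ S ∖ v → z ≢ v
  ∈∖⇒≢ z∈ refl = x∈∁p⇒x∉p (proj₂ (x∈p∩q⁻ _ _ z∈)) (x∈⁅x⁆ _)

  ∈∖∖⁺ : ∀ {S z l} → z ∈ S → All (z ≢_) l → z ∈ S ∖∖ l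
  ∈∖∖⁺ z∈S []        = z∈S
  ∈∖∖⁺ z∈S (z≢ ∷ z≢s) = ∈∖∖⁺ (∈∖⁺ z∈S z≢) z≢s

  ∈∖∖⁻ : ∀ {S z} l → z ∈ S ∖∖ l → z ∈ S × All (z ≢_) l
  ∈∖∖⁻ []      z∈ = z∈ , []
  ∈∖∖⁻ (v ∷ l) z∈ with ∈∖∖⁻ l z∈
  ... | z∈S∖v , z≢l = ∈∖⇒∈ z∈S∖v , ∈∖⇒≢ z∈S∖v ∷ z≢l

  ∖-mono : ∀ {S T v} → S ⊆ T → S ∖ v ⊆ T ∖ v
  ∖-mono S⊆T z∈ = ∈∖⁺ (S⊆T (∈∖⇒∈ z∈)) (∈∖⇒≢ z∈)

  ∖∖-⊆ : ∀ {S} l l′ → All (_∈ₗ l) l′ → S ∖∖ l ⊆ S ∖∖ l′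
  ∖∖-⊆ l l′ l′⊆l z∈ with ∈∖∖⁻ l z∈
  ... | z∈S , z≢l = ∈∖∖⁺ z∈S (All.map (All.lookup z≢l) l′⊆l)

  ∖∖-cong : ∀ {S l l′} → All (_∈ₗ l) l′ → All (_∈ₗ l′) l → S ∖∖ l ≡ S ∖∖ l′
  ∖∖-cong {l = l} {l′} p q = ⊆-antisym (∖∖-⊆ l l′ p) (∖∖-⊆ l′ l q)

  ⟦_⟧ : ∀ {ℓ} {P : Pred (Fin n) ℓ} → Decidable P → Subset n
  ⟦ P? ⟧ = tabulate (does ∘ P?)

  module _ {ℓ} {P : Pred (Fin n) ℓ} (P? : Decidable P) where

    ∈⟦⟧⁺ : ∀ {z} → P z → z ∈ ⟦ P? ⟧
    ∈⟦⟧⁺ {z} Pz = lookup⇒[]= z _ (trans (lookup∘tabulate _ z) (dec-true (P? z) Pz))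

    ∈⟦⟧⁻ : ∀ {z} → z ∈ ⟦ P? ⟧ → P z
    ∈⟦⟧⁻ {z} z∈ with P? z | trans (sym (lookup∘tabulate (does ∘ P?) z)) ([]=⇒lookup z∈)
    ... | yes Pz | _ = Pz
    ... | no _   | ()

∣∖∣ : ∀ {n} {S : Subset n} {v} → v ∈ S → ∣ S ∣ ≡ suc ∣ S ∖ v ∣
∣∖∣ {S = inside ∷ S} here = cong (suc ∘ ∣_∣) (sym (trans (cong (S ∩_) (∁∅ _)) (∩-identityʳ S)))
  where
  ∁∅ : ∀ m → ∁ (∅ {m}) ≡ ⊤
  ∁∅ zero    = refl
  ∁∅ (suc m) = cong (inside ∷_) (∁∅ m)
∣∖∣ {S = inside  ∷ S} (there v∈S) = cong suc (∣∖∣ v∈S)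
∣∖∣ {S = outside ∷ S} (there v∈S) = ∣∖∣ v∈S

module _ {n : ℕ} where

  ∣∖∖∣₂ : ∀ {S : Subset n} {v w} → v ∈ S → w ∈ S → w ≢ v → ∣ S ∣ ≡ 2 + ∣ S ∖ v ∖ w ∣
  ∣∖∖∣₂ v∈S w∈S w≢v = trans (∣∖∣ v∈S) (cong suc (∣∖∣ (∈∖⁺ w∈S w≢v)))

  ∣∣≡0 : ∀ {S : Subset n} → (∀ z → z ∉ S) → ∣ S ∣ ≡ 0
  ∣∣≡0 ∉S = trans (cong ∣_∣ (Empty-unique λ (z , z∈S) → ∉S z z∈S)) (∣⊥∣≡0 n)

-- Adjacency and reachability

module _ (G : Graph) where
  open Graph G using (n; adj) renaming (sym to adj-sym; irrefl to adj-irrefl)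

  infix 4 _~_ _~?_ _≈_ _≈?_ _∈ₗ?_

  _∈ₗ?_ : (v : Fin n) (l : List (Fin n)) → Dec (v ∈ₗ l)
  _∈ₗ?_ = ∈ₗ-dec _≟_

  _~_ : Fin n → Fin n → Set
  _~_ = E G

  _~?_ : ∀ u v → Dec (u ~ v)
  u ~? v = adj u v Bool.≟ true

  ~-sym : ∀ {u v} → u ~ v → v ~ u
  ~-sym {u} {v} e = trans (adj-sym v u) e

  ~⇒≢ : ∀ {u v} → u ~ v → u ≢ v
  ~⇒≢ {u} e refl with trans (sym e) (adj-irrefl u)
  ... | ()

  _≈_ : Fin n → Fin n → Set
  u ≈ v = u ≡ v ⊎ u ~ v

  _≈?_ : ∀ u v → Dec (u ≈ v)
  u ≈? v = (u ≟ v) ⊎-dec (u ~? v)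

  ≈-sym : ∀ {u v} → u ≈ v → v ≈ u
  ≈-sym (inj₁ refl) = inj₁ refl
  ≈-sym (inj₂ e)    = inj₂ (~-sym e)

  Reach-∈ˡ : ∀ {S u v} → Reach G S u v → u ∈ S
  Reach-∈ˡ (here u∈S)   = u∈S
  Reach-∈ˡ (step r _ _) = Reach-∈ˡ r

  Reach-∈ʳ : ∀ {S u v} → Reach G S u v → v ∈ S
  Reach-∈ʳ (here u∈S)     = u∈S
  Reach-∈ʳ (step _ _ v∈S) = v∈S

  Reach-mono : ∀ {S T u v} → S ⊆ T → Reach G S u v → Reach G T u v
  Reach-mono S⊆T (here u∈S)     = here (S⊆T u∈S)
  Reach-mono S⊆T (step r e v∈S) = step (Reach-mono S⊆T r) e (S⊆T v∈S)

  Reach-trans : ∀ {S u v w} → Reach G S u v → Reach G S v w → Reach G S u w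
  Reach-trans r (here _)       = r
  Reach-trans r (step s e w∈S) = step (Reach-trans r s) e w∈S

  Reach-cons : ∀ {S u v w} → u ∈ S → u ~ v → Reach G S v w → Reach G S u w
  Reach-cons u∈S e r = Reach-trans (step (here u∈S) e (Reach-∈ˡ r)) r

  Reach-sym : ∀ {S u v} → Reach G S u v → Reach G S v u
  Reach-sym (here u∈S)     = here u∈S
  Reach-sym (step r e v∈S) = Reach-cons v∈S (~-sym e) (Reach-sym r)

  Reach-≈ : ∀ {S u v} → u ∈ S → v ∈ S → u ≈ v → Reach G S u v
  Reach-≈ u∈S v∈S (inj₁ refl) = here u∈S
  Reach-≈ u∈S v∈S (inj₂ e)    = step (here u∈S) e v∈S

  -- Simple paths and decidability of reachability

  data Path : Subset n → Fin n → Fin n → Set where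
    nil  : ∀ {S u} → u ∈ S → Path S u u
    cons : ∀ {S u v w} → u ∈ S → u ~ v → Path (S ∖ u) v w → Path S u w

  path⇒reach : ∀ {S u v} → Path S u v → Reach G S u v
  path⇒reach (nil u∈S)      = here u∈S
  path⇒reach (cons u∈S e p) = Reach-cons u∈S e (Reach-mono ∈∖⇒∈ (path⇒reach p))

  -- The walk is cut at its last visit to `u`; what follows never returns to `u`. Repeating this
  -- turns a walk into a simple path.
  lastExit : ∀ {S u w} → Reach G S u w → u ≡ w ⊎ ∃ λ v → u ~ v × Reach G (S ∖ u) v w
  lastExit (here _) = inj₁ refl
  lastExit {S} {u} (step {y} {z} r e z∈S) with u ≟ z | lastExit r
  ... | yes u≡z | _                   = inj₁ u≡z
  ... | no u≢z  | inj₁ refl           = inj₂ (z , e , here (∈∖⁺ z∈S (u≢z ∘ sym)))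
  ... | no u≢z  | inj₂ (v , e′ , r′) = inj₂ (v , e′ , step r′ e (∈∖⁺ z∈S (u≢z ∘ sym)))

  reach⇒path : ∀ {S u w} → Reach G S u w → Path S u w
  reach⇒path r = go _ r ℕ.≤-refl
    where
    go : ∀ k {S u w} → Reach G S u w → ∣ S ∣ ≤ k → Path S u w
    go k r ∣S∣≤k with lastExit r
    ... | inj₁ refl = nil (Reach-∈ˡ r)
    go zero r ∣S∣≤0 | inj₂ _ = case subst (_≤ 0) (∣∖∣ (Reach-∈ˡ r)) ∣S∣≤0 of λ ()
    go (suc k) r ∣S∣≤k | inj₂ (v , e , r′) =
      cons (Reach-∈ˡ r) e (go k r′ (ℕ.≤-pred (subst (_≤ suc k) (∣∖∣ (Reach-∈ˡ r)) ∣S∣≤k)))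

  -- Exhaustive search over the first edge. Each step deletes a vertex from `S`, so `∣ S ∣` bounds
  -- the depth.
  path? : ∀ S u w → Dec (Path S u w)
  path? S u w = go _ S u ℕ.≤-refl
    where
    go : ∀ k S u → ∣ S ∣ ≤ k → Dec (Path S u w)
    go k S u ∣S∣≤k with u ∈? S | u ≟ w
    ... | no u∉S  | _        = no (u∉S ∘ Reach-∈ˡ ∘ path⇒reach)
    ... | yes u∈S | yes refl = yes (nil u∈S)
    go zero S u ∣S∣≤0 | yes u∈S | no u≢w = case subst (_≤ 0) (∣∖∣ u∈S) ∣S∣≤0 of λ ()
    go (suc k) S u ∣S∣≤k | yes u∈S | no u≢w =
      map′ (λ (v , e , p) → cons u∈S e p)
           (λ { (nil _) → ⊥-elim (u≢w refl) ; (cons _ e p) → _ , e , p })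
           (any? λ v → (u ~? v) ×-dec go k (S ∖ u) v (ℕ.≤-pred (subst (_≤ suc k) (∣∖∣ u∈S) ∣S∣≤k)))

  reach? : ∀ S u w → Dec (Reach G S u w)
  reach? S u w = map′ path⇒reach reach⇒path (path? S u w)

  -- Blocks: decidability and existence

  connectedOn? : ∀ S → Dec (ConnectedOn G S)
  connectedOn? S = any? (_∈? S) ×-dec
    all? λ u → all? λ v → (u ∈? S) →-dec (v ∈? S) →-dec reach? S u v

  cutVertexOf? : ∀ S v → Dec (CutVertexOf G S v)
  cutVertexOf? S v = (v ∈? S) ×-dec any? λ x → any? λ y →
    (x ∈? S ∖ v) ×-dec (y ∈? S ∖ v) ×-dec ¬? (reach? (S ∖ v) x y)

  nonSeparable? : ∀ S → Dec (NonSeparable G S)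
  nonSeparable? S = connectedOn? S ×-dec all? λ v → ¬? (cutVertexOf? S v)

  Extension : Subset n → Set
  Extension S = ∃ λ T → S ⊆ T × NonSeparable G T × ∃ λ z → z ∈ T × z ∉ S

  extension? : ∀ S → Dec (Extension S)
  extension? S = anySubset? λ T → (S ⊆? T) ×-dec nonSeparable? T ×-dec any? λ z → (z ∈? T) ×-dec ¬? (z ∈? S)

  maximal : ∀ {S} → ¬ Extension S → ∀ T → S ⊆ T → NonSeparable G T → T ⊆ S
  maximal {S} ¬ext T S⊆T ns {z} z∈T = decidable-stable (z ∈? S) λ z∉S → ¬ext (T , S⊆T , ns , z , z∈T , z∉S)

  isBlock? : ∀ S → Dec (IsBlock G S)
  isBlock? S = nonSeparable? S ×-dec map′ maximal
    (λ max (T , S⊆T , ns , z , z∈T , z∉S) → z∉S (max T S⊆T ns z∈T)) (¬? (extension? S))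

  odd-pred² : ∀ {m} → Odd G (2 + m) → Odd G m
  odd-pred² (suc k , eq) = k , ℕ.suc-injective (ℕ.suc-injective (trans eq (cong suc (ℕ.*-suc 2 k))))

  odd-suc² : ∀ {m} → Odd G m → Odd G (2 + m)
  odd-suc² (k , eq) = suc k , trans (cong (2 +_) eq) (cong suc (sym (ℕ.*-suc 2 k)))

  odd? : ∀ m → Dec (Odd G m)
  odd? 0             = no λ ()
  odd? 1             = yes (0 , refl)
  odd? (suc (suc m)) = map′ odd-suc² odd-pred² (odd? m)

  oddComplete? : ∀ S → Dec (OddComplete G S)
  oddComplete? S = (all? λ x → all? λ y → (x ∈? S) →-dec (y ∈? S) →-dec ¬? (x ≟ y) →-dec (x ~? y))
    ×-dec odd? ∣ S ∣

  -- A nonseparable set that is not maximal is replaced by a strictly larger one. In `go`, `k`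
  -- bounds the number of vertices still missing.
  extendToBlock : ∀ {S} → NonSeparable G S → ∃ λ B → IsBlock G B × S ⊆ B
  extendToBlock {S} ns = go n S ns (ℕ.m≤m+n n ∣ S ∣)
    where
    go : ∀ k S → NonSeparable G S → n ≤ k + ∣ S ∣ → ∃ λ B → IsBlock G B × S ⊆ B
    go k S ns n≤ with extension? S
    ... | no ¬ext = S , (ns , maximal ¬ext) , λ z∈S → z∈S
    go zero S ns n≤ | yes (T , S⊆T , _ , z∈T∖S) =
      ⊥-elim (ℕ.<-irrefl refl (ℕ.<-≤-trans (p⊂q⇒∣p∣<∣q∣ (S⊆T , z∈T∖S)) (ℕ.≤-trans (∣p∣≤n T) n≤)))
    go (suc k) S ns n≤ | yes (T , S⊆T , ns′ , z∈T∖S)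
      with go k T ns′ (ℕ.≤-trans n≤ (ℕ.≤-trans (ℕ.≤-reflexive (sym (ℕ.+-suc k ∣ S ∣)))
             (ℕ.+-monoʳ-≤ k (p⊂q⇒∣p∣<∣q∣ (S⊆T , z∈T∖S)))))
    ... | B , block , T⊆B = B , block , λ z∈S → T⊆B (S⊆T z∈S)

  -- Local description of graphs with odd complete blocks

  commonNbrs : Subset n → Fin n → Fin n → Subset n
  commonNbrs U p q = ⟦ (λ z → (z ∈? U) ×-dec (z ≈? p) ×-dec (z ≈? q)) ⟧

  ∈common⁺ : ∀ {U p q z} → z ∈ U → z ≈ p → z ≈ q → z ∈ commonNbrs U p q
  ∈common⁺ z∈U z≈p z≈q = ∈⟦⟧⁺ (λ z → (z ∈? _) ×-dec (z ≈? _) ×-dec (z ≈? _)) (z∈U , z≈p , z≈q)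

  ∈common⁻ : ∀ {U p q z} → z ∈ commonNbrs U p q → z ∈ U × z ≈ p × z ≈ q
  ∈common⁻ {U} {p} {q} = ∈⟦⟧⁻ (λ z → (z ∈? U) ×-dec (z ≈? p) ×-dec (z ≈? q))

  -- For connected U this says that every block of the graph induced on U is complete.
  LocallySeparating : Subset n → Set
  LocallySeparating U = ∀ {v a b} → v ∈ U → v ~ a → v ~ b → a ≢ b → ¬ a ~ b → ¬ Reach G (U ∖ v) a b

  separating⇒≈ : ∀ {U v a b} → LocallySeparating U → v ∈ U → v ~ a → v ~ b → Reach G (U ∖ v) a b → a ≈ b
  separating⇒≈ {a = a} {b} sep v∈U v~a v~b r = decidable-stable (a ≈? b)
    λ a≉b → sep v∈U v~a v~b (a≉b ∘ inj₁) (a≉b ∘ inj₂) r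

  -- When all blocks are complete, the block through an edge `p q` is exactly the set of vertices
  -- equal or adjacent to both ends. So this is the oddness of the blocks that contain an edge;
  -- singleton blocks are odd anyway.
  OddCliques : Subset n → Set
  OddCliques U = ∀ {p q} → p ∈ U → q ∈ U → p ~ q → Odd G ∣ commonNbrs U p q ∣

  complete⇒≈ : ∀ {S x y} → CompleteOn G S → x ∈ S → y ∈ S → x ≈ y
  complete⇒≈ {x = x} {y} complete x∈S y∈S with x ≟ y
  ... | yes x≡y = inj₁ x≡y
  ... | no x≢y  = inj₂ (complete x y x∈S y∈S x≢y)

  complete⇒nonSeparable : ∀ {S v} → v ∈ S → CompleteOn G S → NonSeparable G S
  complete⇒nonSeparable v∈S complete =
    ((_ , v∈S) , λ x y x∈S y∈S → Reach-≈ x∈S y∈S (complete⇒≈ complete x∈S y∈S)) ,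
    λ c (_ , x , y , x∈ , y∈ , ¬r) → ¬r (Reach-≈ x∈ y∈ (complete⇒≈ complete (∈∖⇒∈ x∈) (∈∖⇒∈ y∈)))

  vertices : ∀ {S u w} → Path S u w → Subset n
  vertices (nil {u = u} _)      = ⁅ u ⁆
  vertices (cons {u = u} _ _ p) = ⁅ u ⁆ ∪ vertices p

  ∈vertices⇒∈ : ∀ {S u w z} (p : Path S u w) → z ∈ vertices p → z ∈ S
  ∈vertices⇒∈ (nil u∈S) z∈ with refl ← x∈⁅y⁆⇒x≡y _ z∈ = u∈S
  ∈vertices⇒∈ (cons u∈S _ p) z∈ with x∈p∪q⁻ _ _ z∈
  ... | inj₁ z∈u with refl ← x∈⁅y⁆⇒x≡y _ z∈u = u∈S
  ... | inj₂ z∈p = ∈∖⇒∈ (∈vertices⇒∈ p z∈p)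

  source∈ : ∀ {S u w} (p : Path S u w) → u ∈ vertices p
  source∈ (nil _)      = x∈⁅x⁆ _
  source∈ (cons _ _ _) = x∈p∪q⁺ (inj₁ (x∈⁅x⁆ _))

  vertices-tail : ∀ {S u v w} {u∈S : u ∈ S} {e : u ~ v} (p : Path (S ∖ u) v w) → vertices p ⊆ vertices (cons u∈S e p)
  vertices-tail p z∈ = x∈p∪q⁺ (inj₂ z∈)

  toTarget : ∀ {S u w z} (p : Path S u w) → z ∈ vertices p → Reach G (vertices p) z w
  toTarget (nil _) z∈ with refl ← x∈⁅y⁆⇒x≡y _ z∈ = here z∈
  toTarget (cons u∈S e p) z∈ with x∈p∪q⁻ _ _ z∈
  ... | inj₁ z∈u with refl ← x∈⁅y⁆⇒x≡y _ z∈u = Reach-cons z∈ e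
      (Reach-mono (vertices-tail {u∈S = u∈S} {e} p) (toTarget p (source∈ p)))
  ... | inj₂ z∈p = Reach-mono (vertices-tail {u∈S = u∈S} {e} p) (toTarget p z∈p)

  -- Deleting `c` breaks a simple path into at most two pieces, and each piece keeps an end of the
  -- path.
  toEndpoint : ∀ {S u w z c} (p : Path S u w) → z ∈ vertices p ∖ c →
               Reach G (vertices p ∖ c) z u ⊎ Reach G (vertices p ∖ c) z w
  toEndpoint (nil _) z∈ with refl ← x∈⁅y⁆⇒x≡y _ (∈∖⇒∈ z∈) = inj₁ (here z∈)
  toEndpoint {u = u} {c = c} (cons u∈S e p) z∈ with x∈p∪q⁻ _ _ (∈∖⇒∈ z∈)
  ... | inj₁ z∈u with refl ← x∈⁅y⁆⇒x≡y _ z∈u = inj₁ (here z∈)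
  ... | inj₂ z∈p with toEndpoint p (∈∖⁺ z∈p (∈∖⇒≢ z∈))
  ...   | inj₂ r = inj₂ (Reach-mono (∖-mono (vertices-tail {u∈S = u∈S} {e} p)) r)
  ...   | inj₁ r with u ≟ c
  ...     | no u≢c = inj₁ (step (Reach-mono (∖-mono (vertices-tail {u∈S = u∈S} {e} p)) r) (~-sym e)
                             (∈∖⁺ (source∈ (cons u∈S e p)) u≢c))
  ...     | yes refl = inj₂ (Reach-mono (λ y∈ → ∈∖⁺ (vertices-tail {u∈S = u∈S} {e} p y∈)
      (∈∖⇒≢ (∈vertices⇒∈ p y∈))) (toTarget p z∈p))

  -- The vertex `v` serves as a hub. After deletion of another vertex, every remaining vertex of the
  -- path still reaches an end of it, and both ends are adjacent to `v`. After deletion of `v` the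
  -- path itself is connected.
  cycle-nonSeparable : ∀ {S v a b} → v ~ a → v ~ b → (p : Path (S ∖ v) a b) → NonSeparable G (⁅ v ⁆ ∪ vertices p)
  cycle-nonSeparable {v = v} {a} {b} v~a v~b p =
    ((v , v∈T) , λ x y x∈T y∈T → Reach-trans (toHub x∈T) (Reach-sym (toHub y∈T))) , noCut
    where
    T = ⁅ v ⁆ ∪ vertices p

    v∈T : v ∈ T
    v∈T = x∈p∪q⁺ (inj₁ (x∈⁅x⁆ _))

    p⊆T : vertices p ⊆ T
    p⊆T z∈p = x∈p∪q⁺ (inj₂ z∈p)

    ∈T⁻ : ∀ {z} → z ∈ T → z ≡ v ⊎ z ∈ vertices p
    ∈T⁻ z∈T with x∈p∪q⁻ _ _ z∈T
    ... | inj₁ z∈v = inj₁ (x∈⁅y⁆⇒x≡y _ z∈v)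
    ... | inj₂ z∈p = inj₂ z∈p

    toHub : ∀ {z} → z ∈ T → Reach G T z v
    toHub z∈T with ∈T⁻ z∈T
    ... | inj₁ refl = here z∈T
    ... | inj₂ z∈p  = step (Reach-mono p⊆T (toTarget p z∈p)) (~-sym v~b) v∈T

    toHub∖ : ∀ {c z} → c ≢ v → z ∈ T ∖ c → Reach G (T ∖ c) z v
    toHub∖ c≢v z∈ with ∈T⁻ (∈∖⇒∈ z∈)
    ... | inj₁ refl = here z∈
    ... | inj₂ z∈p with toEndpoint p (∈∖⁺ z∈p (∈∖⇒≢ z∈))
    ...   | inj₁ r = step (Reach-mono (∖-mono p⊆T) r) (~-sym v~a) (∈∖⁺ v∈T (c≢v ∘ sym))
    ...   | inj₂ r = step (Reach-mono (∖-mono p⊆T) r) (~-sym v~b) (∈∖⁺ v∈T (c≢v ∘ sym))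

    inPath : ∀ {z} → z ∈ T ∖ v → z ∈ vertices p
    inPath z∈ with ∈T⁻ (∈∖⇒∈ z∈)
    ... | inj₁ z≡v = ⊥-elim (∈∖⇒≢ z∈ z≡v)
    ... | inj₂ z∈p = z∈p

    noCut : ∀ c → ¬ CutVertexOf G T c
    noCut c (_ , x , y , x∈ , y∈ , ¬r) with c ≟ v
    ... | no c≢v = ¬r (Reach-trans (toHub∖ c≢v x∈) (Reach-sym (toHub∖ c≢v y∈)))
    ... | yes refl = ¬r (Reach-mono (λ z∈p → ∈∖⁺ (p⊆T z∈p) (∈∖⇒≢ (∈vertices⇒∈ p z∈p)))
            (Reach-trans (toTarget p (inPath x∈)) (Reach-sym (toTarget p (inPath y∈)))))

  -- Two common neighbours of `p` and `q` are joined through `q` without using `p`, so local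
  -- separation at `p` makes them adjacent.
  common-complete : ∀ {U p q} → LocallySeparating U → p ∈ U → q ∈ U → p ~ q → CompleteOn G (commonNbrs U p q)
  common-complete {U} {p} {q} sep p∈U q∈U p~q c d c∈ d∈ c≢d with ∈common⁻ c∈ | ∈common⁻ d∈
  ... | _ , inj₁ refl , _ | _ , inj₁ refl , _ = ⊥-elim (c≢d refl)
  ... | _ , inj₁ refl , _ | _ , inj₂ d~p , _  = ~-sym d~p
  ... | _ , inj₂ c~p , _  | _ , inj₁ refl , _ = c~p
  ... | c∈U , inj₂ c~p , c≈q | d∈U , inj₂ d~p , d≈q =
    [ ⊥-elim ∘ c≢d , (λ c~d → c~d) ]′
      (separating⇒≈ sep p∈U (~-sym c~p) (~-sym d~p) (Reach-trans (Reach-≈ c∈U∖p q∈U∖p c≈q)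
          (Reach-≈ q∈U∖p d∈U∖p (≈-sym d≈q))))
    where
    c∈U∖p = ∈∖⁺ c∈U (~⇒≢ c~p)
    d∈U∖p = ∈∖⁺ d∈U (~⇒≢ d~p)
    q∈U∖p = ∈∖⁺ q∈U (~⇒≢ p~q ∘ sym)

  module _ (oddBlocks : ∀ S → IsBlock G S → OddComplete G S) where

    -- A path from a to b avoiding v closes up to a cycle, which lies in a complete block.
    oddBlocks⇒separating : LocallySeparating ⊤
    oddBlocks⇒separating _ v~a v~b a≢b a≁b r
      with p ← reach⇒path r
      with B , block , T⊆B ← extendToBlock (cycle-nonSeparable v~a v~b p) =
      a≁b (proj₁ (oddBlocks B block) _ _ (T⊆B (x∈p∪q⁺ (inj₂ (source∈ p))))
          (T⊆B (x∈p∪q⁺ (inj₂ (Reach-∈ʳ (toTarget p (source∈ p)))))) a≢b)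

    -- The common neighbours form a clique and so lie in some block. That block is complete and
    -- contains `p` and `q`, hence has no further vertices.
    oddBlocks⇒oddCliques : OddCliques ⊤
    oddBlocks⇒oddCliques {p} {q} _ _ p~q
      with B , block , K⊆B ← extendToBlock (complete⇒nonSeparable (∈common⁺ ∈⊤ (inj₁ refl) (inj₂ p~q))
                               (common-complete oddBlocks⇒separating ∈⊤ ∈⊤ p~q))
      with complete , odd ← oddBlocks B block =
      subst (λ K → Odd G ∣ K ∣) (⊆-antisym B⊆K K⊆B) odd
      where
      B⊆K : B ⊆ commonNbrs ⊤ p q
      B⊆K z∈B = ∈common⁺ ∈⊤ (complete⇒≈ complete z∈B (K⊆B (∈common⁺ ∈⊤ (inj₁ refl) (inj₂ p~q))))
                            (complete⇒≈ complete z∈B (K⊆B (∈common⁺ ∈⊤ (inj₂ (~-sym p~q)) (inj₁ refl))))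

  -- Along a walk in `S` from `x`, every vertex stays equal or adjacent to `x`: at the first
  -- failure, the preceding vertex would separate its two neighbours and be a cut vertex of `S`.
  nonSeparable-complete : ∀ {S} → LocallySeparating ⊤ → NonSeparable G S → CompleteOn G S
  nonSeparable-complete {S} sep ((_ , conn) , noCut) x y x∈S y∈S x≢y =
    [ ⊥-elim ∘ x≢y , (λ e → e) ]′ (close (conn x y x∈S y∈S))
    where
    close : ∀ {z} → Reach G S x z → x ≈ z
    close (here _) = inj₁ refl
    close {z} (step {y} r e z∈S) with close r | x ≈? z
    ... | _         | yes x≈z = x≈z
    ... | inj₁ refl | no x≉z  = inj₂ e
    ... | inj₂ x~y  | no x≉z  = ⊥-elim (noCut y (Reach-∈ʳ r , x , z , ∈∖⁺ x∈S (~⇒≢ x~y) , ∈∖⁺ z∈S (~⇒≢ e ∘ sym) ,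
      λ r′ → sep ∈⊤ (~-sym x~y) e (x≉z ∘ inj₁) (x≉z ∘ inj₂) (Reach-mono (∖-mono ⊆⊤) r′)))

  -- A block is a single vertex, of order one, or by maximality the common neighbourhood of any of
  -- its edges.
  block-oddComplete : ∀ {S} → LocallySeparating ⊤ → OddCliques ⊤ → IsBlock G S → OddComplete G S
  block-oddComplete {S} sep odd (ns@(((v , v∈S) , _) , _) , max)
    with complete ← nonSeparable-complete sep ns
    with any? (λ w → (w ∈? S) ×-dec ¬? (w ≟ v))
  ... | no ¬w = complete , 0 , trans (∣∖∣ v∈S) (cong suc (∣∣≡0 {S = S ∖ v} λ z z∈ → ¬w (z , ∈∖⇒∈ z∈ , ∈∖⇒≢ z∈)))
  ... | yes (w , w∈S , w≢v) = complete , subst (λ K → Odd G ∣ K ∣) (⊆-antisym K⊆S S⊆K) (odd ∈⊤ ∈⊤ v~w)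
    where
    v~w = complete v w v∈S w∈S (w≢v ∘ sym)
    S⊆K : S ⊆ commonNbrs ⊤ v w
    S⊆K z∈S = ∈common⁺ ∈⊤ (complete⇒≈ complete z∈S v∈S) (complete⇒≈ complete z∈S w∈S)
    K⊆S : commonNbrs ⊤ v w ⊆ S
    K⊆S = max _ S⊆K (complete⇒nonSeparable (S⊆K v∈S) (common-complete sep ∈⊤ ∈⊤ v~w))

  -- Odd cliques exclude a mate for every vertex

  Reach-avoid : ∀ {S u v w} → ¬ Reach G S u v → Reach G S u w → Reach G (S ∖ v) u w
  Reach-avoid ¬r (here u∈S)     = here (∈∖⁺ u∈S λ { refl → ¬r (here u∈S) })
  Reach-avoid ¬r (step r e z∈S) = step (Reach-avoid ¬r r) e (∈∖⁺ z∈S λ { refl → ¬r (step r e z∈S) })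

  module _
    (Mate : Fin n → Fin n → Set)
    (mate? : ∀ u v → Dec (Mate u v))
    (mate⇒~ : ∀ {u v} → Mate u v → u ~ v)
    (mate-sym : ∀ {u v} → Mate u v → Mate v u)
    (mates-nonadjacent : ∀ {u v w} → Mate u v → Mate u w → ¬ v ~ w)
    where

    -- Mates of one vertex are nonadjacent, so inside a clique each vertex has only one mate.
    -- Deleting a mated pair therefore leaves all other vertices with their mates.
    matedClique-even : ∀ k {K} → ∣ K ∣ ≤ k → CompleteOn G K → (∀ {u} → u ∈ K → ∃ λ w → w ∈ K × Mate u w) → ¬ Odd G ∣ K ∣
    matedClique-even k {K} ∣K∣≤k complete mated odd with any? (_∈? K)
    ... | no ∉K = case subst (Odd G) (∣∣≡0 λ z z∈K → ∉K (z , z∈K)) odd of λ ()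
    ... | yes (u , u∈K) with mated u∈K
    ...   | w , w∈K , uw with ∣∖∖∣₂ u∈K w∈K (~⇒≢ (~-sym (mate⇒~ uw)))
    matedClique-even zero    ∣K∣≤k complete mated odd | yes (u , u∈K) | w , w∈K , uw | eq =
      case subst (_≤ 0) eq ∣K∣≤k of λ ()
    matedClique-even (suc k) {K} ∣K∣≤k complete mated odd | yes (u , u∈K) | w , w∈K , uw | eq =
      matedClique-even k (ℕ.≤-trans (ℕ.n≤1+n _) (ℕ.≤-pred (subst (_≤ suc k) eq ∣K∣≤k)))
        (λ x y x∈ y∈ → complete x y (∈∖⇒∈ (∈∖⇒∈ x∈)) (∈∖⇒∈ (∈∖⇒∈ y∈))) mated′ (odd-pred² (subst (Odd G) eq odd))
      where
      mates-unique : ∀ {x y z} → y ∈ K → z ∈ K → Mate x y → Mate x z → y ≡ z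
      mates-unique y∈K z∈K xy xz =
        [ (λ y≡z → y≡z) , ⊥-elim ∘ mates-nonadjacent xy xz ]′ (complete⇒≈ complete y∈K z∈K)
      mated′ : ∀ {x} → x ∈ K ∖ u ∖ w → ∃ λ y → y ∈ K ∖ u ∖ w × Mate x y
      mated′ x∈ with mated (∈∖⇒∈ (∈∖⇒∈ x∈))
      ... | y , y∈K , xy = y , ∈∖⁺ (∈∖⁺ y∈K y≢u) y≢w , xy
        where
        y≢u : y ≢ u
        y≢u refl = ∈∖⇒≢ x∈ (mates-unique (∈∖⇒∈ (∈∖⇒∈ x∈)) w∈K (mate-sym xy) uw)
        y≢w : y ≢ w
        y≢w refl = ∈∖⇒≢ (∈∖⇒∈ x∈) (mates-unique (∈∖⇒∈ (∈∖⇒∈ x∈)) u∈K (mate-sym xy) (mate-sym uw))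

    module _ (hasMate : ∀ v → ∃ (Mate v)) (sep : LocallySeparating ⊤) (odd : OddCliques ⊤) where

      component : Fin n → Fin n → Subset n
      component v w = ⟦ reach? (⊤ ∖ v) w ⟧

      -- The odd clique through the edge v w has a vertex u mated outside the clique; the part of
      -- the graph that hangs on u beyond its mate is strictly smaller than the part hanging on v beyond w.
      noMate : ∀ k {v w} → ∣ component v w ∣ < k → ¬ Mate v w
      noMate (suc k) {v} {w} <k vw
        with any? (λ u → (u ∈? commonNbrs ⊤ v w) ×-dec ¬? (any? λ x → (x ∈? commonNbrs ⊤ v w) ×-dec mate? u x))
      -- If every vertex had a mate inside the clique, the clique would have even order.
      ... | no ¬unmated = matedClique-even _ ℕ.≤-refl (common-complete sep ∈⊤ ∈⊤ v~w)
              (λ {u} u∈K → decidable-stable (any? λ x → (x ∈? commonNbrs ⊤ v w) ×-dec mate? u x) λ ¬m → ¬unmated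
                  (u , u∈K , ¬m))
              (odd ∈⊤ ∈⊤ v~w)
        where v~w = mate⇒~ vw
      ... | yes (u , u∈K , unmated) with hasMate u
      ...   | u′ , uu′ = noMate k (ℕ.<-≤-trans (p⊂q⇒∣p∣<∣q∣ (shrink , u , u∈D , u∉D′)) (ℕ.≤-pred <k)) uu′
        where
        v~w = mate⇒~ vw
        u~u′ = mate⇒~ uu′
        v∈K : v ∈ commonNbrs ⊤ v w
        v∈K = ∈common⁺ ∈⊤ (inj₁ refl) (inj₂ v~w)
        w∈K : w ∈ commonNbrs ⊤ v w
        w∈K = ∈common⁺ ∈⊤ (inj₂ (~-sym v~w)) (inj₁ refl)
        u′∉K : u′ ∉ commonNbrs ⊤ v w
        u′∉K u′∈K = unmated (u′ , u′∈K , uu′)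
        u≢v : u ≢ v
        u≢v refl = unmated (w , w∈K , vw)
        u≢w : u ≢ w
        u≢w refl = unmated (v , v∈K , mate-sym vw)
        u~v : u ~ v
        u~v = [ ⊥-elim ∘ u≢v , (λ e → e) ]′ (proj₁ (proj₂ (∈common⁻ {⊤} {v} {w} u∈K)))
        u~w : u ~ w
        u~w = [ ⊥-elim ∘ u≢w , (λ e → e) ]′ (proj₂ (proj₂ (∈common⁻ {⊤} {v} {w} u∈K)))
        u′≢v : u′ ≢ v
        u′≢v refl = u′∉K v∈K
        w→u : Reach G (⊤ ∖ v) w u
        w→u = Reach-≈ (∈∖⁺ ∈⊤ (~⇒≢ (~-sym v~w))) (∈∖⁺ ∈⊤ u≢v) (inj₂ (~-sym u~w))
        w→u′ : Reach G (⊤ ∖ v) w u′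
        w→u′ = step w→u u~u′ (∈∖⁺ ∈⊤ u′≢v)
        -- If `v` were adjacent to `u′`, then, as `w` and `u′` are joined through `u` off `v`, they
        -- would be adjacent too and `u′` would lie in the clique.
        v≁u′ : ¬ v ~ u′
        v≁u′ v~u′ = u′∉K (∈common⁺ ∈⊤ (inj₂ (~-sym v~u′)) (separating⇒≈ sep ∈⊤ v~u′ v~w (Reach-sym w→u′)))
        separated : ¬ Reach G (⊤ ∖ u) u′ v
        separated r = sep ∈⊤ u~v u~u′ (u′≢v ∘ sym) v≁u′ (Reach-sym r)
        -- Walks from `u′` off `u` never meet `v`, so they continue the walk `w`, `u`, `u′` inside
        -- the graph without `v`. The vertex `u` itself makes the inclusion strict.
        shrink : component u u′ ⊆ component v w
        shrink z∈ = ∈⟦⟧⁺ (reach? (⊤ ∖ v) w) (Reach-trans w→u′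
          (Reach-mono (∖-mono ⊆⊤) (Reach-avoid separated (∈⟦⟧⁻ (reach? (⊤ ∖ u) u′) z∈))))
        u∈D : u ∈ component v w
        u∈D = ∈⟦⟧⁺ (reach? (⊤ ∖ v) w) w→u
        u∉D′ : u ∉ component u u′
        u∉D′ u∈ = ∈∖⇒≢ (Reach-∈ʳ (∈⟦⟧⁻ (reach? (⊤ ∖ u) u′) u∈)) refl

  -- From an induced path decomposition to a block

  Consecutive : ℕ → ℕ → Set
  Consecutive i j = j ≡ suc i ⊎ i ≡ suc j

  consecutive-noTriangle : ∀ {i j k} → Consecutive i j → Consecutive i k → ¬ Consecutive j k
  consecutive-noTriangle (inj₁ refl) (inj₁ refl) (inj₁ ())
  consecutive-noTriangle (inj₁ refl) (inj₁ refl) (inj₂ ())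
  consecutive-noTriangle (inj₁ refl) (inj₂ refl) (inj₁ ())
  consecutive-noTriangle (inj₁ refl) (inj₂ refl) (inj₂ ())
  consecutive-noTriangle (inj₂ refl) (inj₁ refl) (inj₁ ())
  consecutive-noTriangle (inj₂ refl) (inj₁ refl) (inj₂ ())
  consecutive-noTriangle (inj₂ refl) (inj₂ refl) (inj₁ ())
  consecutive-noTriangle (inj₂ refl) (inj₂ refl) (inj₂ ())

  -- Here the order at least two of the paths enters: the first vertex has a successor, every other
  -- one a predecessor.
  consecutiveIndex : ∀ {m} → 2 ≤ m → (i : Fin m) → ∃ λ j → Consecutive (toℕ i) (toℕ {m} j)
  consecutiveIndex (s≤s (s≤s _)) zero = suc zero , inj₁ refl
  consecutiveIndex _ (suc i) = inject₁ i , inj₂ (cong suc (sym (toℕ-inject₁ i)))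

  ++-unique-disjoint : ∀ {v : Fin n} xs {ys} → Unique (xs ++ ys) → v ∈ₗ xs → ¬ v ∈ₗ ys
  ++-unique-disjoint (x ∷ xs) (x≢ ∷ _) (here refl)  v∈ys = All.lookup x≢ (∈-++⁺ʳ xs v∈ys) refl
  ++-unique-disjoint (x ∷ xs) (_ ∷ u)  (there v∈xs) v∈ys = ++-unique-disjoint xs u v∈xs v∈ys

  ++-uniqueʳ : ∀ (xs : List (Fin n)) {ys} → Unique (xs ++ ys) → Unique ys
  ++-uniqueʳ []       u       = u
  ++-uniqueʳ (x ∷ xs) (_ ∷ u) = ++-uniqueʳ xs u

  concat-unique : ∀ {v : Fin n} {p q} ps → Unique (concat ps) → p ∈ₗ ps → q ∈ₗ ps → v ∈ₗ p → v ∈ₗ q → p ≡ q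
  concat-unique (p ∷ ps) u (here refl) (here refl) _ _ = refl
  concat-unique (p ∷ ps) u (here refl) (there q∈) v∈p v∈q = ⊥-elim (++-unique-disjoint p u v∈p (∈-concat⁺′ v∈q q∈))
  concat-unique (p ∷ ps) u (there p∈) (here refl) v∈p v∈q = ⊥-elim (++-unique-disjoint p u v∈q (∈-concat⁺′ v∈p p∈))
  concat-unique (p ∷ ps) u (there p∈) (there q∈) = concat-unique ps (++-uniqueʳ p u) p∈ q∈

  adjacent⇒consecutive : ∀ {p u v} → IsInducedPath G p → (u∈p : u ∈ₗ p) (v∈p : v ∈ₗ p) → u ~ v →
                         Consecutive (toℕ (index u∈p)) (toℕ (index v∈p))
  adjacent⇒consecutive (_ , path) u∈p v∈p u~v =
    Equivalence.to (path (index u∈p) (index v∈p)) (subst₂ _~_ (lookup-index u∈p) (lookup-index v∈p) u~v)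

  -- The blocks can be searched. If all of them were odd and complete, then no two vertices could be
  -- mates, whereas every vertex has a neighbour on its path.
  IPD⇒block : HasIPD G → Connected G → ∃ λ S → IsBlock G S × ¬ OddComplete G S
  IPD⇒block (ps , paths , unique , covers) ((v₀ , _) , _)
    with anySubset? (λ S → isBlock? S ×-dec ¬? (oddComplete? S))
  ... | yes block = block
  ... | no ¬block = ⊥-elim (noMate Mate mate? proj₁ mate-sym mates-nonadjacent hasMate
          (oddBlocks⇒separating oddBlocks) (oddBlocks⇒oddCliques oddBlocks) _ ℕ.≤-refl (proj₂ (hasMate v₀)))
    where
    oddBlocks : ∀ S → IsBlock G S → OddComplete G S
    oddBlocks S block = decidable-stable (oddComplete? S) λ ¬odd → ¬block (S , block , ¬odd)

    -- As the paths are induced, an edge of `G` between two vertices of one path is an edge of that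
    -- path.
    Mate : Fin n → Fin n → Set
    Mate u v = u ~ v × Any (λ p → u ∈ₗ p × v ∈ₗ p) ps

    mate? : ∀ u v → Dec (Mate u v)
    mate? u v = (u ~? v) ×-dec Any.any? (λ p → (u ∈ₗ? p) ×-dec (v ∈ₗ? p)) ps

    mate-sym : ∀ {u v} → Mate u v → Mate v u
    mate-sym (e , any) = ~-sym e , Any.map swap any

    -- All three vertices lie on the unique path through `u`, and three positions on a path are
    -- never pairwise consecutive.
    mates-nonadjacent : ∀ {u v w} → Mate u v → Mate u w → ¬ v ~ w
    mates-nonadjacent (u~v , any) (u~w , any′) v~w
      with find any | find any′
    ... | p , p∈ps , u∈p , v∈p | q , q∈ps , u∈q , w∈q
      with refl ← concat-unique ps unique p∈ps q∈ps u∈p u∈q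
      with path , _ ← All.lookup paths p∈ps =
      consecutive-noTriangle (adjacent⇒consecutive path u∈p v∈p u~v) (adjacent⇒consecutive path u∈p w∈q u~w)
                             (adjacent⇒consecutive path v∈p w∈q v~w)

    hasMate : ∀ v → ∃ (Mate v)
    hasMate v with ∈-concat⁻′ ps (covers v)
    ... | p , v∈p , p∈ps with All.lookup paths p∈ps
    ...   | (_ , path) , 2≤∣p∣ with consecutiveIndex 2≤∣p∣ (index v∈p)
    ...     | j , consecutive = lookup p j ,
      subst (_~ lookup p j) (sym (lookup-index v∈p)) (Equivalence.from (path (index v∈p) j) consecutive) ,
      lose p∈ps (v∈p , ∈-lookup j)

  -- Removing an edge from a connected claw-free graph

  Reach-closed : ∀ {S u w} (P : Fin n → Set) → P u → (∀ {v z} → P v → v ~ z → z ∈ S → P z) → Reach G S u w → P w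
  Reach-closed P Pu closed (here _)       = Pu
  Reach-closed P Pu closed (step r e z∈S) = closed (Reach-closed P Pu closed r) e z∈S

  singleton-connected : ∀ v → ConnectedOn G ⁅ v ⁆
  singleton-connected v = (v , x∈⁅x⁆ v) , λ x y x∈ y∈ →
    Reach-≈ x∈ y∈ (inj₁ (trans (x∈⁅y⁆⇒x≡y v x∈) (sym (x∈⁅y⁆⇒x≡y v y∈))))

  insert-connected : ∀ {R u w} → ConnectedOn G R → w ∈ R → w ~ u → ConnectedOn G (R ∪ ⁅ u ⁆)
  insert-connected {R} {u} {w} (_ , conn) w∈R w~u =
    (u , u∈) , λ x y x∈ y∈ → Reach-trans (toNew x∈) (Reach-sym (toNew y∈))
    where
    u∈ : u ∈ R ∪ ⁅ u ⁆
    u∈ = x∈p∪q⁺ (inj₂ (x∈⁅x⁆ u))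
    toNew : ∀ {x} → x ∈ R ∪ ⁅ u ⁆ → Reach G (R ∪ ⁅ u ⁆) x u
    toNew x∈ with x∈p∪q⁻ _ _ x∈
    ... | inj₁ x∈R = step (Reach-mono (p⊆p∪q ⁅ u ⁆) (conn _ w x∈R w∈R)) w~u u∈
    ... | inj₂ x∈u with refl ← x∈⁅y⁆⇒x≡y _ x∈u = here x∈

  ∉insert : ∀ {R : Subset n} {u v} → v ∉ R → v ≢ u → v ∉ R ∪ ⁅ u ⁆
  ∉insert v∉R v≢u v∈ = [ v∉R , v≢u ∘ x∈⁅y⁆⇒x≡y _ ]′ (x∈p∪q⁻ _ _ v∈)

  insert-⊆ : ∀ {R U : Subset n} {u} → R ⊆ U → u ∈ U → R ∪ ⁅ u ⁆ ⊆ U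
  insert-⊆ {U = U} R⊆U u∈U z∈ = [ R⊆U , (λ z∈u → subst (_∈ U) (sym (x∈⁅y⁆⇒x≡y _ z∈u)) u∈U) ]′ (x∈p∪q⁻ _ _ z∈)

  ∣insert∣ : ∀ {R : Subset n} {u} → u ∉ R → ∣ R ∣ < ∣ R ∪ ⁅ u ⁆ ∣
  ∣insert∣ {R} {u} u∉R = p⊂q⇒∣p∣<∣q∣ (p⊆p∪q ⁅ u ⁆ , u , x∈p∪q⁺ (inj₂ (x∈⁅x⁆ u)) , u∉R)

  Peelable : Subset n → Set
  Peelable U = ∃ λ x → ∃ λ y → x ∈ U × y ∈ U × x ~ y × ConnectedOn G (U ∖ x ∖ y)

  -- The edge `x y` is the candidate for removal; it succeeds once `R` contains all other vertices
  -- of `U`.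
  record Tail (U R : Subset n) : Set where
    constructor tail
    field
      {x y z} : Fin n
      x∈U : x ∈ U
      y∈U : y ∈ U
      x∉R : x ∉ R
      y∉R : y ∉ R
      z∈R : z ∈ R
      x~y : x ~ y
      y~z : y ~ z

  -- While a path x y z ending in a connected set R leaves part of U uncovered, a new vertex either
  -- joins R or starts a longer path into a larger R.
  growTail : ∀ {U} → ClawFree G → ConnectedOn G U → ∀ k {R} → ∣ U ∣ ≤ k + ∣ R ∣ → R ⊆ U → ConnectedOn G R →
             Tail U R → Peelable U
  growTail {U} clawFree connU k {R} ≤k R⊆U connR (tail {x} {y} {z} x∈U y∈U x∉R y∉R z∈R x~y y~z) = attach
    where
    New : Fin n → Set
    New u = u ∈ U × u ∉ R × u ≢ x × u ≢ y

    new? : ∀ u → Dec (New u)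
    new? u = (u ∈? U) ×-dec ¬? (u ∈? R) ×-dec ¬? (u ≟ x) ×-dec ¬? (u ≟ y)

    -- The bound `k` on the vertices of `U` outside `R` drops when `u` joins `R`; it cannot be zero
    -- while `u` is still outside.
    next : ∀ {u} → u ∈ U → u ∉ R → ConnectedOn G (R ∪ ⁅ u ⁆) → Tail U (R ∪ ⁅ u ⁆) → Peelable U
    next = go k ≤k
      where
      go : ∀ k → ∣ U ∣ ≤ k + ∣ R ∣ → ∀ {u} → u ∈ U → u ∉ R → ConnectedOn G (R ∪ ⁅ u ⁆) →
           Tail U (R ∪ ⁅ u ⁆) → Peelable U
      go zero ≤k u∈U u∉R =
        ⊥-elim (ℕ.<-irrefl refl (ℕ.<-≤-trans (∣insert∣ u∉R) (ℕ.≤-trans (p⊆q⇒∣p∣≤∣q∣ (insert-⊆ R⊆U u∈U)) ≤k)))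
      go (suc k) ≤k u∈U u∉R conn =
        growTail clawFree connU k
          (ℕ.≤-trans ≤k (ℕ.≤-trans (ℕ.≤-reflexive (sym (ℕ.+-suc k ∣ R ∣))) (ℕ.+-monoʳ-≤ k (∣insert∣ u∉R))))
          (insert-⊆ R⊆U u∈U) conn

    attach : Peelable U
    attach with any? (λ u → new? u ×-dec any? λ w → (w ∈? R) ×-dec (w ~? u))
    ... | yes (u , (u∈U , u∉R , u≢x , u≢y) , w , w∈R , w~u) =
      next u∈U u∉R (insert-connected connR w∈R w~u)
        (tail x∈U y∈U (∉insert x∉R (u≢x ∘ sym)) (∉insert y∉R (u≢y ∘ sym)) (x∈p∪q⁺ (inj₁ z∈R)) x~y y~z)
    ... | no ¬atR with any? (λ u → new? u ×-dec (u ~? x))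
    -- The tail becomes `u x y`, and its old middle vertex `y` joins `R`.
    ...   | yes (u , (u∈U , u∉R , u≢x , u≢y) , u~x) =
      next y∈U y∉R (insert-connected connR z∈R (~-sym y~z))
        (tail u∈U x∈U (∉insert u∉R u≢y) (∉insert x∉R (~⇒≢ x~y)) (x∈p∪q⁺ (inj₂ (x∈⁅x⁆ y))) u~x x~y)
    ...   | no ¬atx with any? (λ u → new? u ×-dec (u ~? y)) | x ~? z
    -- Here `x` can join `R` directly through `z`, and the tail becomes `u y x`.
    ...     | yes (u , (u∈U , u∉R , u≢x , u≢y) , u~y) | yes x~z =
      next x∈U x∉R (insert-connected connR z∈R (~-sym x~z))
        (tail u∈U y∈U (∉insert u∉R u≢x) (∉insert y∉R (~⇒≢ (~-sym x~y))) (x∈p∪q⁺ (inj₂ (x∈⁅x⁆ x))) u~y (~-sym x~y))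
    -- Otherwise `y` is the centre of a claw with leaves `u`, `x`, `z`.
    ...     | yes (u , new@(u∈U , u∉R , u≢x , u≢y) , u~y) | no x≁z =
      ⊥-elim (clawFree y u x z (~-sym u~y) (~-sym x~y) y~z u≢x (λ { refl → u∉R z∈R }) (λ { refl → x∉R z∈R })
        (λ u~x → ¬atx (u , new , u~x)) (λ u~z → ¬atR (u , new , z , z∈R , ~-sym u~z)) x≁z)
    -- No edge leaves `R` together with `x` and `y`, so by connectedness these are all of `U`.
    ...     | no ¬aty | _ =
      x , y , x∈U , y∈U , x~y , subst (ConnectedOn G) (⊆-antisym R⊆ ⊆R) connR
      where
      Old : Fin n → Set
      Old v = v ∈ R ⊎ v ≡ x ⊎ v ≡ y
      old : ∀ {v} → v ∈ U → ¬ New v → Old v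
      old {v} v∈U ¬new with v ∈? R | v ≟ x | v ≟ y
      ... | yes v∈R | _ | _ = inj₁ v∈R
      ... | no _ | yes v≡x | _ = inj₂ (inj₁ v≡x)
      ... | no _ | no _ | yes v≡y = inj₂ (inj₂ v≡y)
      ... | no v∉R | no v≢x | no v≢y = ⊥-elim (¬new (v∈U , v∉R , v≢x , v≢y))
      closed : ∀ {v w} → Old v → v ~ w → w ∈ U → Old w
      closed (inj₁ v∈R)         v~w w∈U = old w∈U λ new → ¬atR (_ , new , _ , v∈R , v~w)
      closed (inj₂ (inj₁ refl)) v~w w∈U = old w∈U λ new → ¬atx (_ , new , ~-sym v~w)
      closed (inj₂ (inj₂ refl)) v~w w∈U = old w∈U λ new → ¬aty (_ , new , ~-sym v~w)
      R⊆ : R ⊆ U ∖ x ∖ y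
      R⊆ v∈R = ∈∖⁺ (∈∖⁺ (R⊆U v∈R) λ { refl → x∉R v∈R }) λ { refl → y∉R v∈R }
      ⊆R : U ∖ x ∖ y ⊆ R
      ⊆R v∈ with Reach-closed Old (inj₁ z∈R) closed (proj₂ connU _ _ (R⊆U z∈R) (∈∖⇒∈ (∈∖⇒∈ v∈)))
      ... | inj₁ v∈R         = v∈R
      ... | inj₂ (inj₁ v≡x) = ⊥-elim (∈∖⇒≢ (∈∖⇒∈ v∈) v≡x)
      ... | inj₂ (inj₂ v≡y) = ⊥-elim (∈∖⇒≢ v∈ v≡y)

  -- Beyond one vertex there is an edge `v s`. If a third vertex `t` is adjacent to one of its ends,
  -- the growth starts from the singleton of `t` with `v s` as tail; otherwise connectedness leaves
  -- only `v` and `s`.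
  peel : ∀ {U} → ClawFree G → ConnectedOn G U →
         (∃ λ v → v ∈ U × ∀ {z} → z ∈ U → z ≡ v) ⊎
         (∃ λ x → ∃ λ y → x ∈ U × y ∈ U × x ~ y × ∀ {z} → z ∈ U → z ≡ x ⊎ z ≡ y) ⊎
         Peelable U
  peel {U} clawFree connU@((v , v∈U) , conn) with any? (λ w → (w ∈? U) ×-dec ¬? (w ≟ v))
  ... | no ¬w = inj₁ (v , v∈U , λ {z} z∈U → decidable-stable (z ≟ v) λ z≢v → ¬w (z , z∈U , z≢v))
  ... | yes (w , w∈U , w≢v) with lastExit (conn v w v∈U w∈U)
  ...   | inj₁ v≡w = ⊥-elim (w≢v (sym v≡w))
  ...   | inj₂ (s , v~s , r) with s∈U ← ∈∖⇒∈ (Reach-∈ˡ r)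
      with any? (λ t → (t ∈? U) ×-dec ¬? (t ≟ v) ×-dec ¬? (t ≟ s) ×-dec ((v ~? t) ⊎-dec (s ~? t)))
  ...     | yes (t , t∈U , t≢v , t≢s , inj₁ v~t) = inj₂ (inj₂
    (growTail clawFree connU _ (ℕ.m≤m+n ∣ U ∣ _) (λ z∈ → subst (_∈ U) (sym (x∈⁅y⁆⇒x≡y t z∈)) t∈U) (singleton-connected t)
      (tail s∈U v∈U (t≢s ∘ sym ∘ x∈⁅y⁆⇒x≡y t) (t≢v ∘ sym ∘ x∈⁅y⁆⇒x≡y t) (x∈⁅x⁆ t) (~-sym v~s) v~t)))
  ...     | yes (t , t∈U , t≢v , t≢s , inj₂ s~t) = inj₂ (inj₂
    (growTail clawFree connU _ (ℕ.m≤m+n ∣ U ∣ _) (λ z∈ → subst (_∈ U) (sym (x∈⁅y⁆⇒x≡y t z∈)) t∈U) (singleton-connected t)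
      (tail v∈U s∈U (t≢v ∘ sym ∘ x∈⁅y⁆⇒x≡y t) (t≢s ∘ sym ∘ x∈⁅y⁆⇒x≡y t) (x∈⁅x⁆ t) v~s s~t)))
  ...     | no ¬t = inj₂ (inj₁ (v , s , v∈U , s∈U , v~s , λ z∈U → Reach-closed Old (inj₁ refl) closed (conn _ _ v∈U z∈U)))
    where
    Old : Fin n → Set
    Old z = z ≡ v ⊎ z ≡ s
    closed : ∀ {u z} → Old u → u ~ z → z ∈ U → Old z
    closed {z = z} old e z∈U with z ≟ v | z ≟ s
    ... | yes z≡v | _       = inj₁ z≡v
    ... | no _    | yes z≡s = inj₂ z≡s
    closed {z = z} (inj₁ refl) e z∈U | no z≢v | no z≢s = ⊥-elim (¬t (z , z∈U , z≢v , z≢s , inj₁ e))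
    closed {z = z} (inj₂ refl) e z∈U | no z≢v | no z≢s = ⊥-elim (¬t (z , z∈U , z≢v , z≢s , inj₂ e))

  -- Perfect matchings and tilings by edges and induced three-vertex paths

  data Matched (U : Subset n) : Set where
    done : (∀ z → z ∉ U) → Matched U
    pair : ∀ {x y} → x ∈ U → y ∈ U → x ~ y → Matched (U ∖ x ∖ y) → Matched U

  data Tiled (U : Subset n) : Set where
    matched : Matched U → Tiled U
    edge    : ∀ {x y} → x ∈ U → y ∈ U → x ~ y → Tiled (U ∖ x ∖ y) → Tiled U
    path₃   : ∀ {x y z} → x ∈ U → y ∈ U → z ∈ U → x ~ y → y ~ z → x ≢ z → ¬ x ~ z →
              Tiled (U ∖ x ∖ y ∖ z) → Tiled U

  ∖∖-reorder : ∀ {U} l l′ → All (_∈ₗ l) l′ → All (_∈ₗ l′) l → Matched (U ∖∖ l) → Matched (U ∖∖ l′)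
  ∖∖-reorder {U} l l′ p q = subst Matched (∖∖-cong {S = U} {l} {l′} p q)

  -- The pairs of a matching may be removed in any order, so the pair of `b` can be brought to the
  -- front.
  matchedTo : ∀ {U b} → Matched U → b ∈ U → ∃ λ c → b ~ c × c ∈ U ∖ b × Matched (U ∖ b ∖ c)
  matchedTo {b = b} (done ∉U) b∈U = ⊥-elim (∉U b b∈U)
  matchedTo {U} {b} (pair {x} {y} x∈U y∈U x~y M) b∈U with b ≟ x | b ≟ y
  ... | yes refl | _        = y , x~y , ∈∖⁺ y∈U (~⇒≢ (~-sym x~y)) , M
  ... | no _     | yes refl = x , ~-sym x~y , ∈∖⁺ x∈U (~⇒≢ x~y) ,
    ∖∖-reorder (x ∷ y ∷ []) (y ∷ x ∷ []) (there (here refl) ∷ here refl ∷ [])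
      (there (here refl) ∷ here refl ∷ []) M
  ... | no b≢x   | no b≢y with matchedTo M (∈∖∖⁺ {l = x ∷ y ∷ []} b∈U (b≢x ∷ b≢y ∷ []))
  ...   | c , b~c , c∈ , M′ with ∈∖∖⁻ (x ∷ y ∷ b ∷ []) c∈
  ...     | c∈U , c≢x ∷ c≢y ∷ c≢b ∷ [] = c , b~c , ∈∖⁺ c∈U c≢b ,
    pair (∈∖∖⁺ {l = b ∷ c ∷ []} x∈U ((b≢x ∘ sym) ∷ (c≢x ∘ sym) ∷ []))
         (∈∖∖⁺ {l = b ∷ c ∷ []} y∈U ((b≢y ∘ sym) ∷ (c≢y ∘ sym) ∷ [])) x~y
      (∖∖-reorder (x ∷ y ∷ b ∷ c ∷ []) (b ∷ c ∷ x ∷ y ∷ []) swapped swapped M′)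
    where
    swapped : ∀ {p q r s : Fin n} → All (_∈ₗ p ∷ q ∷ r ∷ s ∷ []) (r ∷ s ∷ p ∷ q ∷ [])
    swapped = there (there (here refl)) ∷ there (there (there (here refl))) ∷ here refl ∷ there (here refl) ∷ []

  -- Each entry is required to lie in what the earlier ones leave of `S`, the form in which `pair`
  -- and `path₃` consume vertices.
  data Distinct (S : Subset n) : List (Fin n) → Set where
    []  : Distinct S []
    _∷_ : ∀ {x l} → x ∈ S → Distinct (S ∖ x) l → Distinct S (x ∷ l)

  distinct⁻ : ∀ {S l} → Distinct S l → All (_∈ S) l × Unique l
  distinct⁻ []        = [] , []
  distinct⁻ (x∈S ∷ d) with distinct⁻ d
  ... | l⊆ , unique = x∈S ∷ All.map ∈∖⇒∈ l⊆ , All.map (λ z∈ → ∈∖⇒≢ z∈ ∘ sym) l⊆ ∷ unique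

  distinct⁺ : ∀ {S l} → All (_∈ S) l → Unique l → Distinct S l
  distinct⁺ []         []              = []
  distinct⁺ (x∈S ∷ l⊆) (x≢ ∷ unique) =
    x∈S ∷ distinct⁺ (All.zipWith (λ (z∈S , x≢z) → ∈∖⁺ z∈S (x≢z ∘ sym)) (l⊆ , x≢)) unique

  data Pairing : List (Fin n) → Set where
    []  : Pairing []
    _∷_ : ∀ {x y l} → x ~ y → Pairing l → Pairing (x ∷ y ∷ l)

  matchPairs : ∀ {U l} → Distinct U l → Pairing l → Matched (U ∖∖ l) → Matched U
  matchPairs []               []      M = M
  matchPairs (x∈ ∷ (y∈ ∷ d)) (e ∷ ps) M = pair x∈ (∈∖⇒∈ y∈) e (matchPairs d ps M)

  Permutes : ∀ {k} → List (Fin k) → Set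
  Permutes is = (∀ i → i ∈ₗ is) × Unique is

  permutes? : ∀ {k} (is : List (Fin k)) → Dec (Permutes is)
  permutes? is = all? (λ i → ∈ₗ-dec _≟_ i is) ×-dec DecUnique.unique? _≟_ is

  lookup-injective : ∀ {l : List (Fin n)} → Unique l → ∀ {i j} → lookup l i ≡ lookup l j → i ≡ j
  lookup-injective (_ ∷ _)  {zero}  {zero}  _  = refl
  lookup-injective (x≢ ∷ _) {zero}  {suc j} eq = ⊥-elim (All.lookup x≢ (∈-lookup j) eq)
  lookup-injective (x≢ ∷ _) {suc i} {zero}  eq = ⊥-elim (All.lookup x≢ (∈-lookup i) (sym eq))
  lookup-injective (_ ∷ u)  {suc i} {suc j} eq = cong suc (lookup-injective u eq)

  module _ {U l} (d : Distinct U l) (M : Matched (U ∖∖ l)) (is : List (Fin (length l))) (perm : Permutes is) where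

    permuted-distinct : Distinct U (map (lookup l) is)
    permuted-distinct with distinct⁻ d
    ... | l⊆ , unique = distinct⁺ (All.map⁺ (All.universal (λ i → All.lookup l⊆ (∈-lookup i)) is))
                                  (Unique.map⁺ (lookup-injective unique) (proj₂ perm))

    permuted-matched : Matched (U ∖∖ map (lookup l) is)
    permuted-matched = ∖∖-reorder l (map (lookup l) is)
      (All.map⁺ (All.universal (λ i → ∈-lookup i) is))
      (All.tabulate λ z∈ → subst (_∈ₗ _) (sym (lookup-index z∈)) (∈-map⁺ (lookup l) (proj₁ perm (index z∈)))) M

  -- Tiles are given by positions in l, so that using each entry exactly once is decided by computation.
  tile-path₃ : ∀ {U l} → Distinct U l → Matched (U ∖∖ l) → ∀ p q r is {_ : True (permutes? (p ∷ q ∷ r ∷ is))} →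
               lookup l p ~ lookup l q → lookup l q ~ lookup l r → ¬ lookup l p ~ lookup l r →
               Pairing (map (lookup l) is) → Tiled U
  tile-path₃ d M p q r is {perm} p~q q~r p≁r ps
    with permuted-distinct d M (p ∷ q ∷ r ∷ is) (toWitness perm)
  ... | p∈ ∷ (q∈ ∷ (r∈ ∷ rest)) =
    path₃ p∈ (∈∖⇒∈ q∈) (∈∖⇒∈ (∈∖⇒∈ r∈)) p~q q~r (∈∖⇒≢ (∈∖⇒∈ r∈) ∘ sym) p≁r
      (matched (matchPairs rest ps (permuted-matched d M (p ∷ q ∷ r ∷ is) (toWitness perm))))

  -- For connected `U`, these are the graphs whose blocks are all complete of odd order. The
  -- matchings in `nearMatched` are the raw material for rerouting through a new edge.
  record OddBlockGraph (U : Subset n) : Set where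
    field
      nearMatched : ∀ {v} → v ∈ U → Matched (U ∖ v)
      separating  : LocallySeparating U
      oddCliques  : OddCliques U

  -- Putting the removed edge back

  module _ {U x y} (x∈U : x ∈ U) (y∈U : y ∈ U) (x~y : x ~ y) (connU : ConnectedOn G U)
           (nonempty : ∃ λ v → v ∈ U ∖ x ∖ y) (rest : OddBlockGraph (U ∖ x ∖ y)) where

    open OddBlockGraph rest

    private
      U′ : Subset n
      U′ = U ∖ x ∖ y

      y∈U∖x : y ∈ U ∖ x
      y∈U∖x = ∈∖⁺ y∈U (~⇒≢ (~-sym x~y))

      Attached : Fin n → Set
      Attached v = v ∈ U′ × x ~ v

      attached? : ∀ v → Dec (Attached v)
      attached? v = (v ∈? U′) ×-dec (x ~? v)

    -- The path `v x y` is induced, and the rest without `v` has a perfect matching.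
    tile-distinguished : ∀ {v} → v ∈ U′ → x ~ v → ¬ y ~ v → Tiled U
    tile-distinguished v∈U′ x~v y≁v =
      tile-path₃ (x∈U ∷ (y∈U∖x ∷ (v∈U′ ∷ []))) (nearMatched v∈U′) 2F 0F 1F [] (~-sym x~v) x~y (y≁v ∘ ~-sym) []

    tile-distinguished′ : ∀ {v} → v ∈ U′ → ¬ x ~ v → y ~ v → Tiled U
    tile-distinguished′ v∈U′ x≁v y~v =
      tile-path₃ (x∈U ∷ (y∈U∖x ∷ (v∈U′ ∷ []))) (nearMatched v∈U′) 2F 1F 0F [] (~-sym y~v) (~-sym x~y) (x≁v ∘ ~-sym) []

    module _ (twins : ∀ {v} → Attached v → y ~ v) where

      -- In both lemmas b′ and c′ are the mates of b and c in a perfect matching of U′ without a.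
      tile-nonadjacent : ∀ {a b} → Attached a → Attached b → a ≢ b → ¬ a ~ b → Tiled U
      tile-nonadjacent {a} {b} (a∈ , x~a) (b∈ , x~b) a≢b a≁b
        with b∈′ ← ∈∖⁺ b∈ (a≢b ∘ sym)
        with matchedTo (nearMatched a∈) b∈′
      ... | b′ , b~b′ , b′∈ , M with d ← x∈U ∷ (y∈U∖x ∷ (a∈ ∷ (b∈′ ∷ (b′∈ ∷ [])))) | x ~? b′
      -- Tiles: the path `b′ b x` and the edge `y a`. In the other case: the path `a x b` and the
      -- edge `y b′`.
      ...   | no x≁b′  = tile-path₃ d M 4F 3F 0F (1F ∷ 2F ∷ []) (~-sym b~b′) (~-sym x~b) (x≁b′ ∘ ~-sym)
          (twins (a∈ , x~a) ∷ [])
      ...   | yes x~b′ = tile-path₃ d M 2F 0F 3F (1F ∷ 4F ∷ []) (~-sym x~a) x~b a≁b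
                           (twins (∈∖⇒∈ (∈∖⇒∈ b′∈) , x~b′) ∷ [])

      tile-commonNbr : ∀ {a b c} → Attached a → Attached b → a ≢ b → c ∈ U′ → ¬ x ~ c → a ~ c → b ~ c → Tiled U
      tile-commonNbr {a} {b} {c} (a∈ , x~a) (b∈ , x~b) a≢b c∈ x≁c a~c b~c
        with b∈′ ← ∈∖⁺ b∈ (a≢b ∘ sym)
        with matchedTo (nearMatched a∈) b∈′
      ... | b′ , b~b′ , b′∈ , M with x ~? b′
      ...   | no x≁b′ = tile-path₃ (x∈U ∷ (y∈U∖x ∷ (a∈ ∷ (b∈′ ∷ (b′∈ ∷ []))))) M 4F 3F 0F (1F ∷ 2F ∷ [])
                          (~-sym b~b′) (~-sym x~b) (x≁b′ ∘ ~-sym) (twins (a∈ , x~a) ∷ [])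
      ...   | yes x~b′
        with y~b′ ← twins (∈∖⇒∈ (∈∖⇒∈ b′∈) , x~b′)
        with c∈′ ← ∈∖∖⁺ {l = a ∷ b ∷ b′ ∷ []} c∈ ((~⇒≢ (~-sym a~c)) ∷ (~⇒≢ (~-sym b~c)) ∷ (λ { refl → x≁c x~b′ }) ∷ [])
        with matchedTo M c∈′
      ...     | c′ , c~c′ , c′∈ , M′
        with d ← x∈U ∷ (y∈U∖x ∷ (a∈ ∷ (b∈′ ∷ (b′∈ ∷ (c∈′ ∷ (c′∈ ∷ [])))))) | b ~? c′ | a ~? c′
      -- Tiles: the path `c′ c b` with edges `x a` and `y b′`. The next case exchanges `a` and `b`.
      ...       | no b≁c′ | _ = tile-path₃ d M′ 6F 5F 3F (0F ∷ 2F ∷ 1F ∷ 4F ∷ [])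
                                  (~-sym c~c′) (~-sym b~c) (b≁c′ ∘ ~-sym) (x~a ∷ y~b′ ∷ [])
      ...       | yes _ | no a≁c′ = tile-path₃ d M′ 6F 5F 2F (0F ∷ 3F ∷ 1F ∷ 4F ∷ [])
                                      (~-sym c~c′) (~-sym a~c) (a≁c′ ∘ ~-sym) (x~b ∷ y~b′ ∷ [])
      -- Now `a` can be matched with `c′`, which frees `c` for the path `c b x`; the remaining edge
      -- is `y b′`.
      ...       | yes _ | yes a~c′ = tile-path₃ d M′ 5F 3F 0F (1F ∷ 4F ∷ 2F ∷ 6F ∷ [])
                                       (~-sym b~c) (~-sym x~b) (x≁c ∘ ~-sym) (y~b′ ∷ a~c′ ∷ [])

      -- Twins attached to one vertex or to one whole block

      module _ (clique : ∀ {a b} → Attached a → Attached b → a ≈ b)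
               (closed : ∀ {a b c} → Attached a → Attached b → a ≢ b → c ∈ U′ → a ~ c → b ~ c → x ~ c)
               (distinguished : ∀ {v} → v ∈ U′ → ¬ x ~ v → ¬ y ~ v)
               {a₀} (attached₀ : Attached a₀) where

        private
          data Located (z : Fin n) : Set where
            isX : z ≡ x → Located z
            isY : z ≡ y → Located z
            old : z ∈ U′ → Located z

          locate : ∀ {z} → z ∈ U → Located z
          locate {z} z∈U with z ≟ x | z ≟ y
          ... | yes z≡x | _       = isX z≡x
          ... | no _    | yes z≡y = isY z≡y
          ... | no z≢x  | no z≢y  = old (∈∖∖⁺ {l = x ∷ y ∷ []} z∈U (z≢x ∷ z≢y ∷ []))

          U′⊆U : U′ ⊆ U
          U′⊆U = ∈∖⇒∈ ∘ ∈∖⇒∈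

          attached-y : ∀ {v} → v ∈ U′ → y ~ v → Attached v
          attached-y {v} v∈U′ y~v = v∈U′ , decidable-stable (x ~? v) λ x≁v → distinguished v∈U′ x≁v y~v

          -- This is the common closed neighbourhood of `x` and `y` in `U`: a new triangle, or an
          -- old block enlarged by two vertices.
          data NewClique (z : Fin n) : Set where
            isX : z ≡ x → NewClique z
            isY : z ≡ y → NewClique z
            att : Attached z → NewClique z

          newClique-≈ : ∀ {u v} → NewClique u → NewClique v → u ≈ v
          newClique-≈ (isX refl) (isX refl) = inj₁ refl
          newClique-≈ (isX refl) (isY refl) = inj₂ x~y
          newClique-≈ (isX refl) (att a)    = inj₂ (proj₂ a)
          newClique-≈ (isY refl) (isX refl) = inj₂ (~-sym x~y)
          newClique-≈ (isY refl) (isY refl) = inj₁ refl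
          newClique-≈ (isY refl) (att a)    = inj₂ (twins a)
          newClique-≈ (att a)    (isX refl) = inj₂ (~-sym (proj₂ a))
          newClique-≈ (att a)    (isY refl) = inj₂ (~-sym (twins a))
          newClique-≈ (att a)    (att b)    = clique a b

          nbr-x : ∀ {z} → z ∈ U → x ~ z → NewClique z
          nbr-x z∈U x~z with locate z∈U
          ... | isX z≡x = isX z≡x
          ... | isY z≡y = isY z≡y
          ... | old z∈U′ = att (z∈U′ , x~z)

          nbr-y : ∀ {z} → z ∈ U → y ~ z → NewClique z
          nbr-y z∈U y~z with locate z∈U
          ... | isX z≡x = isX z≡x
          ... | isY z≡y = isY z≡y
          ... | old z∈U′ = att (attached-y z∈U′ y~z)

        -- If one of `x`, `y` is deleted, the other is matched with `a₀`; if an old vertex is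
        -- deleted, `x` is matched with `y`.
        extend-nearMatched : ∀ {v} → v ∈ U → Matched (U ∖ v)
        extend-nearMatched {v} v∈U with locate v∈U
        ... | isX refl = pair y∈U∖x (∈∖⇒∈ (proj₁ attached₀)) (twins attached₀) (nearMatched (proj₁ attached₀))
        ... | isY refl = pair (∈∖⁺ x∈U (~⇒≢ x~y)) (∈∖⁺ (U′⊆U (proj₁ attached₀)) (∈∖⇒≢ (proj₁ attached₀))) (proj₂ attached₀)
          (∖∖-reorder (x ∷ y ∷ a₀ ∷ []) (y ∷ x ∷ a₀ ∷ [])
            (there (here refl) ∷ here refl ∷ there (there (here refl)) ∷ [])
            (there (here refl) ∷ here refl ∷ there (there (here refl)) ∷ []) (nearMatched (proj₁ attached₀)))
        ... | old v∈U′ = pair (∈∖⁺ x∈U (∈∖⇒≢ (∈∖⇒∈ v∈U′) ∘ sym)) (∈∖⁺ y∈U (∈∖⇒≢ v∈U′ ∘ sym)) x~y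
          (∖∖-reorder (x ∷ y ∷ v ∷ []) (v ∷ x ∷ y ∷ [])
            (there (there (here refl)) ∷ here refl ∷ there (here refl) ∷ [])
            (there (here refl) ∷ there (there (here refl)) ∷ here refl ∷ []) (nearMatched v∈U′))

        -- A walk through x and y can be rerouted through the attachment clique.
        Rerouted : Fin n → Fin n → Fin n → Set
        Rerouted v p q = (q ∈ U′ × Reach G (U′ ∖ v) p q) ⊎
                         ((q ≡ x ⊎ q ≡ y) × ∃ λ s → Attached s × Reach G (U′ ∖ v) p s)

        reroute : ∀ {v p q} → p ∈ U′ → Reach G (U ∖ v) p q → Rerouted v p q
        reroute p∈U′ (here p∈) = inj₁ (p∈U′ , here (∈∖⁺ p∈U′ (∈∖⇒≢ p∈)))
        reroute p∈U′ (step r e z∈) with reroute p∈U′ r | locate (∈∖⇒∈ z∈)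
        ... | inj₁ (q∈ , r′) | old z∈U′ = inj₁ (z∈U′ , step r′ e (∈∖⁺ z∈U′ (∈∖⇒≢ z∈)))
        ... | inj₁ (q∈ , r′) | isX refl = inj₂ (inj₁ refl , _ , (q∈ , ~-sym e) , r′)
        ... | inj₁ (q∈ , r′) | isY refl = inj₂ (inj₂ refl , _ , attached-y q∈ (~-sym e) , r′)
        ... | inj₂ (_ , s)   | isX refl = inj₂ (inj₁ refl , s)
        ... | inj₂ (_ , s)   | isY refl = inj₂ (inj₂ refl , s)
        -- The walk left the old part at `s` and re-enters it at `z`; both are attached, so the
        -- detour is replaced by at most one edge.
        ... | inj₂ (inj₁ refl , s , s-att , r′) | old z∈U′ = inj₁ (z∈U′ , Reach-trans r′
          (Reach-≈ (Reach-∈ʳ r′) (∈∖⁺ z∈U′ (∈∖⇒≢ z∈)) (clique s-att (z∈U′ , e))))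
        ... | inj₂ (inj₂ refl , s , s-att , r′) | old z∈U′ = inj₁ (z∈U′ , Reach-trans r′
          (Reach-≈ (Reach-∈ʳ r′) (∈∖⁺ z∈U′ (∈∖⇒≢ z∈)) (clique s-att (attached-y z∈U′ e))))

        private
          -- Being adjacent to `b`, the vertex `v` is attached. The walk leaves the old part at
          -- another attached vertex `s`, so separation at `v` gives `a ≈ s`, and `closed` makes `a`
          -- attached as well.
          old-new-≈ : ∀ {v a b} → v ∈ U′ → a ∈ U′ → v ~ a → v ~ b → b ≡ x ⊎ b ≡ y → Reach G (U ∖ v) a b → a ≈ b
          old-new-≈ {v} {a} v∈U′ a∈U′ v~a v~b b≡ r with reroute a∈U′ r
          ... | inj₁ (b∈U′ , _) =
            [ ⊥-elim ∘ ∈∖⇒≢ (∈∖⇒∈ b∈U′) , ⊥-elim ∘ ∈∖⇒≢ b∈U′ ]′ b≡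
          ... | inj₂ (b≡′ , s , s-att , r′) = newClique-≈ (att (a∈U′ , x~a)) ([ isX , isY ]′ b≡)
            where
            v-att : Attached v
            v-att = [ (λ { refl → v∈U′ , ~-sym v~b }) , (λ { refl → attached-y v∈U′ (~-sym v~b) }) ]′ b≡
            s≢v : s ≢ v
            s≢v = ∈∖⇒≢ (Reach-∈ʳ r′)
            v~s : v ~ s
            v~s = [ (λ v≡s → ⊥-elim (s≢v (sym v≡s))) , (λ e → e) ]′ (clique v-att s-att)
            x~a : x ~ a
            x~a = [ (λ { refl → proj₂ s-att }) , (λ a~s → closed v-att s-att (s≢v ∘ sym) a∈U′ v~a (~-sym a~s)) ]′
                    (separating⇒≈ separating v∈U′ v~a v~s r′)

          extend-≈ : ∀ {v a b} → v ∈ U → v ~ a → v ~ b → Reach G (U ∖ v) a b → a ≈ b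
          extend-≈ v∈U v~a v~b r
            with a∈U ← ∈∖⇒∈ (Reach-∈ˡ r) | b∈U ← ∈∖⇒∈ (Reach-∈ʳ r)
            with locate v∈U | locate a∈U | locate b∈U
          ... | isX refl | _ | _ = newClique-≈ (nbr-x a∈U v~a) (nbr-x b∈U v~b)
          ... | isY refl | _ | _ = newClique-≈ (nbr-y a∈U v~a) (nbr-y b∈U v~b)
          ... | old v∈U′ | old a∈U′ | isX b≡x = old-new-≈ v∈U′ a∈U′ v~a v~b (inj₁ b≡x) r
          ... | old v∈U′ | old a∈U′ | isY b≡y = old-new-≈ v∈U′ a∈U′ v~a v~b (inj₂ b≡y) r
          ... | old v∈U′ | isX a≡x | old b∈U′ = ≈-sym (old-new-≈ v∈U′ b∈U′ v~b v~a (inj₁ a≡x) (Reach-sym r))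
          ... | old v∈U′ | isY a≡y | old b∈U′ = ≈-sym (old-new-≈ v∈U′ b∈U′ v~b v~a (inj₂ a≡y) (Reach-sym r))
          ... | old v∈U′ | isX a≡x | isX b≡x = newClique-≈ (isX a≡x) (isX b≡x)
          ... | old v∈U′ | isX a≡x | isY b≡y = newClique-≈ (isX a≡x) (isY b≡y)
          ... | old v∈U′ | isY a≡y | isX b≡x = newClique-≈ (isY a≡y) (isX b≡x)
          ... | old v∈U′ | isY a≡y | isY b≡y = newClique-≈ (isY a≡y) (isY b≡y)
          ... | old v∈U′ | old a∈U′ | old b∈U′ with reroute a∈U′ r
          ...   | inj₁ (_ , r′) = separating⇒≈ separating v∈U′ v~a v~b r′
          ...   | inj₂ (inj₁ b≡x , _) = ⊥-elim (∈∖⇒≢ (∈∖⇒∈ b∈U′) b≡x)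
          ...   | inj₂ (inj₂ b≡y , _) = ⊥-elim (∈∖⇒≢ b∈U′ b≡y)

        extend-separating : LocallySeparating U
        extend-separating v∈U v~a v~b a≢b a≁b r = [ a≢b , a≁b ]′ (extend-≈ v∈U v~a v~b r)

        -- Either `a₀` is the only attached vertex, or `clique` and `closed` identify the attached
        -- vertices with the odd clique through an edge `a₀ b`.
        attached-odd : Odd G ∣ ⟦ attached? ⟧ ∣
        attached-odd with any? (λ b → attached? b ×-dec ¬? (b ≟ a₀))
        ... | no ¬b = 0 , trans (∣∖∣ (∈⟦⟧⁺ attached? attached₀))
          (cong suc (∣∣≡0 {S = ⟦ attached? ⟧ ∖ a₀} λ z z∈ → ¬b (z , ∈⟦⟧⁻ attached? (∈∖⇒∈ z∈) , ∈∖⇒≢ z∈)))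
        ... | yes (b , b-att , b≢a₀) = subst (λ K → Odd G ∣ K ∣) (⊆-antisym common⊆ ⊆common)
          (oddCliques (proj₁ attached₀) (proj₁ b-att) a₀~b)
          where
          a₀~b : a₀ ~ b
          a₀~b = [ (λ a₀≡b → ⊥-elim (b≢a₀ (sym a₀≡b))) , (λ e → e) ]′ (clique attached₀ b-att)
          ⊆common : ⟦ attached? ⟧ ⊆ commonNbrs U′ a₀ b
          ⊆common z∈ with z-att ← ∈⟦⟧⁻ attached? z∈ =
            ∈common⁺ (proj₁ z-att) (clique z-att attached₀) (clique z-att b-att)
          common⊆ : commonNbrs U′ a₀ b ⊆ ⟦ attached? ⟧
          common⊆ z∈ with ∈common⁻ {U′} {a₀} {b} z∈
          ... | z∈U′ , inj₁ refl , _ = ∈⟦⟧⁺ attached? attached₀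
          ... | z∈U′ , _ , inj₁ refl = ∈⟦⟧⁺ attached? b-att
          ... | z∈U′ , inj₂ z~a₀ , inj₂ z~b =
            ∈⟦⟧⁺ attached? (z∈U′ , closed attached₀ b-att (b≢a₀ ∘ sym) z∈U′ (~-sym z~a₀) (~-sym z~b))

        private
          odd-∖∖ : ∀ {K} → x ∈ K → y ∈ K → Odd G ∣ K ∖ x ∖ y ∣ → Odd G ∣ K ∣
          odd-∖∖ x∈K y∈K odd = subst (Odd G) (sym (∣∖∖∣₂ x∈K y∈K (~⇒≢ (~-sym x~y)))) (odd-suc² odd)

          -- For q ∈ {x, y} the closed neighbourhood of q in U is the new clique.
          odd-new : ∀ {p q} → NewClique p → NewClique q → (∀ {z} → z ∈ U → z ≈ q → NewClique z) → Odd G ∣ commonNbrs U p q ∣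
          odd-new {p} {q} p-new q-new nbrs = odd-∖∖
            (∈common⁺ x∈U (newClique-≈ (isX refl) p-new) (newClique-≈ (isX refl) q-new))
            (∈common⁺ y∈U (newClique-≈ (isY refl) p-new) (newClique-≈ (isY refl) q-new))
            (subst (λ K → Odd G ∣ K ∣) (⊆-antisym attached⊆ ⊆attached) attached-odd)
            where
            attached⊆ : ⟦ attached? ⟧ ⊆ commonNbrs U p q ∖ x ∖ y
            attached⊆ z∈ with z-att ← ∈⟦⟧⁻ attached? z∈ =
              ∈∖⁺ (∈∖⁺ (∈common⁺ (U′⊆U (proj₁ z-att)) (newClique-≈ (att z-att) p-new) (newClique-≈ (att z-att) q-new))
                       (∈∖⇒≢ (∈∖⇒∈ (proj₁ z-att)))) (∈∖⇒≢ (proj₁ z-att))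
            ⊆attached : commonNbrs U p q ∖ x ∖ y ⊆ ⟦ attached? ⟧
            ⊆attached z∈ with ∈common⁻ {U} {p} {q} (∈∖⇒∈ (∈∖⇒∈ z∈))
            ... | z∈U , _ , z≈q with nbrs z∈U z≈q
            ...   | isX z≡x = ⊥-elim (∈∖⇒≢ (∈∖⇒∈ z∈) z≡x)
            ...   | isY z≡y = ⊥-elim (∈∖⇒≢ z∈ z≡y)
            ...   | att z-att = ∈⟦⟧⁺ attached? z-att

          nbrs-x : ∀ {z} → z ∈ U → z ≈ x → NewClique z
          nbrs-x z∈U = [ isX , nbr-x z∈U ∘ ~-sym ]′

          nbrs-y : ∀ {z} → z ∈ U → z ≈ y → NewClique z
          nbrs-y z∈U = [ isY , nbr-y z∈U ∘ ~-sym ]′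

          common-comm : ∀ p q → commonNbrs U p q ≡ commonNbrs U q p
          common-comm p q = ⊆-antisym (flip p q) (flip q p)
            where
            flip : ∀ p q → commonNbrs U p q ⊆ commonNbrs U q p
            flip p q z∈ with ∈common⁻ {U} {p} {q} z∈
            ... | z∈U , z≈p , z≈q = ∈common⁺ z∈U z≈q z≈p

          -- If both ends are attached, the clique gains exactly `x` and `y`; otherwise it gains
          -- nothing. The parity is unchanged.
          odd-old : ∀ {p q} → p ∈ U′ → q ∈ U′ → p ~ q → Odd G ∣ commonNbrs U p q ∣
          odd-old {p} {q} p∈U′ q∈U′ p~q with attached? p ×-dec attached? q
          ... | yes (p-att , q-att) = odd-∖∖
            (∈common⁺ x∈U (inj₂ (proj₂ p-att)) (inj₂ (proj₂ q-att)))
            (∈common⁺ y∈U (inj₂ (twins p-att)) (inj₂ (twins q-att)))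
            (subst (λ K → Odd G ∣ K ∣) (⊆-antisym inner outer) (oddCliques p∈U′ q∈U′ p~q))
            where
            inner : commonNbrs U′ p q ⊆ commonNbrs U p q ∖ x ∖ y
            inner z∈ with ∈common⁻ {U′} {p} {q} z∈
            ... | z∈U′ , z≈p , z≈q = ∈∖⁺ (∈∖⁺ (∈common⁺ (U′⊆U z∈U′) z≈p z≈q) (∈∖⇒≢ (∈∖⇒∈ z∈U′))) (∈∖⇒≢ z∈U′)
            outer : commonNbrs U p q ∖ x ∖ y ⊆ commonNbrs U′ p q
            outer z∈ with ∈common⁻ {U} {p} {q} (∈∖⇒∈ (∈∖⇒∈ z∈))
            ... | z∈U , z≈p , z≈q = ∈common⁺ (∈∖⁺ (∈∖⁺ z∈U (∈∖⇒≢ (∈∖⇒∈ z∈))) (∈∖⇒≢ z∈)) z≈p z≈q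
          ... | no ¬att = subst (λ K → Odd G ∣ K ∣) (⊆-antisym inner outer) (oddCliques p∈U′ q∈U′ p~q)
            where
            ≈x⇒attached : ∀ {v} → v ∈ U′ → x ≈ v → Attached v
            ≈x⇒attached v∈U′ = [ (λ x≡v → ⊥-elim (∈∖⇒≢ (∈∖⇒∈ v∈U′) (sym x≡v))) , (v∈U′ ,_) ]′
            ≈y⇒attached : ∀ {v} → v ∈ U′ → y ≈ v → Attached v
            ≈y⇒attached v∈U′ = [ (λ y≡v → ⊥-elim (∈∖⇒≢ v∈U′ (sym y≡v))) , attached-y v∈U′ ]′
            inner : commonNbrs U′ p q ⊆ commonNbrs U p q
            inner z∈ with ∈common⁻ {U′} {p} {q} z∈
            ... | z∈U′ , z≈p , z≈q = ∈common⁺ (U′⊆U z∈U′) z≈p z≈q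
            outer : commonNbrs U p q ⊆ commonNbrs U′ p q
            outer z∈ with ∈common⁻ {U} {p} {q} z∈
            ... | z∈U , z≈p , z≈q with locate z∈U
            ...   | isX refl = ⊥-elim (¬att (≈x⇒attached p∈U′ z≈p , ≈x⇒attached q∈U′ z≈q))
            ...   | isY refl = ⊥-elim (¬att (≈y⇒attached p∈U′ z≈p , ≈y⇒attached q∈U′ z≈q))
            ...   | old z∈U′ = ∈common⁺ z∈U′ z≈p z≈q

        extend-oddCliques : OddCliques U
        extend-oddCliques {p} {q} p∈U q∈U p~q with locate p∈U | locate q∈U
        ... | old p∈U′ | old q∈U′ = odd-old p∈U′ q∈U′ p~q
        ... | _ | isX refl = odd-new (nbr-x p∈U (~-sym p~q)) (isX refl) nbrs-x
        ... | _ | isY refl = odd-new (nbr-y p∈U (~-sym p~q)) (isY refl) nbrs-y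
        ... | isX refl | _ = subst (λ K → Odd G ∣ K ∣) (common-comm q p) (odd-new (nbr-x q∈U p~q) (isX refl) nbrs-x)
        ... | isY refl | _ = subst (λ K → Odd G ∣ K ∣) (common-comm q p) (odd-new (nbr-y q∈U p~q) (isY refl) nbrs-y)

        extended : OddBlockGraph U
        extended = record
          { nearMatched = extend-nearMatched ; separating = extend-separating ; oddCliques = extend-oddCliques }

    private
      undistinguished : ¬ (∃ λ v → v ∈ U′ × x ~ v × ¬ y ~ v) → ∀ {v} → Attached v → y ~ v
      undistinguished ¬d {v} (v∈U′ , x~v) = decidable-stable (y ~? v) λ y≁v → ¬d (v , v∈U′ , x~v , y≁v)

    -- Each configuration searched for yields a tiling; the absence of all of them supplies the
    -- hypotheses of `extended`.
    tiled⊎extended : Tiled U ⊎ OddBlockGraph U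
    tiled⊎extended
      with any? (λ v → (v ∈? U′) ×-dec (x ~? v) ×-dec ¬? (y ~? v))
    ... | yes (v , v∈U′ , x~v , y≁v) = inj₁ (tile-distinguished v∈U′ x~v y≁v)
    ... | no ¬d
      with any? (λ v → (v ∈? U′) ×-dec ¬? (x ~? v) ×-dec (y ~? v))
    ...   | yes (v , v∈U′ , x≁v , y~v) = inj₁ (tile-distinguished′ v∈U′ x≁v y~v)
    ...   | no ¬d′
      with any? (λ a → any? λ b → attached? a ×-dec attached? b ×-dec ¬? (a ≈? b))
    ...     | yes (a , b , a-att , b-att , a≉b) = inj₁ (tile-nonadjacent (undistinguished ¬d) a-att b-att
        (a≉b ∘ inj₁) (a≉b ∘ inj₂))
    ...     | no ¬nonadjacent
      with any? (λ a → any? λ b → any? λ c → attached? a ×-dec attached? b ×-dec ¬? (a ≟ b) ×-dec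
                  (c ∈? U′) ×-dec ¬? (x ~? c) ×-dec (a ~? c) ×-dec (b ~? c))
    ...       | yes (a , b , c , a-att , b-att , a≢b , c∈ , x≁c , a~c , b~c) =
      inj₁ (tile-commonNbr (undistinguished ¬d) a-att b-att a≢b c∈ x≁c a~c b~c)
    ...       | no ¬commonNbr with any? attached?
    -- With no attached vertex, `x` and `y` would be cut off from the nonempty rest.
    ...         | no ¬attached = ⊥-elim (disconnected nonempty)
      where
      closed : ∀ {v w} → v ≡ x ⊎ v ≡ y → v ~ w → w ∈ U → w ≡ x ⊎ w ≡ y
      closed {w = w} v≡ v~w w∈U with w ≟ x | w ≟ y
      ... | yes w≡x | _       = inj₁ w≡x
      ... | no _    | yes w≡y = inj₂ w≡y
      closed {w = w} (inj₁ refl) v~w w∈U | no w≢x | no w≢y =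
        ⊥-elim (¬attached (w , ∈∖⁺ (∈∖⁺ w∈U w≢x) w≢y , v~w))
      closed {w = w} (inj₂ refl) v~w w∈U | no w≢x | no w≢y =
        ⊥-elim (¬d′ (w , ∈∖⁺ (∈∖⁺ w∈U w≢x) w≢y , (λ x~w → ¬attached (w , ∈∖⁺ (∈∖⁺ w∈U w≢x) w≢y , x~w)) , v~w))
      disconnected : ¬ ∃ λ v → v ∈ U′
      disconnected (v , v∈U′) with Reach-closed (λ w → w ≡ x ⊎ w ≡ y) (inj₁ refl) closed
                                     (proj₂ connU x v x∈U (∈∖⇒∈ (∈∖⇒∈ v∈U′)))
      ... | inj₁ v≡x = ∈∖⇒≢ (∈∖⇒∈ v∈U′) v≡x
      ... | inj₂ v≡y = ∈∖⇒≢ v∈U′ v≡y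
    ...         | yes (a₀ , attached₀) = inj₂ (extended (undistinguished ¬d)
      (λ {a} {b} a-att b-att → decidable-stable (a ≈? b) λ a≉b → ¬nonadjacent (a , b , a-att , b-att , a≉b))
      (λ {a} {b} {c} a-att b-att a≢b c∈ a~c b~c → decidable-stable (x ~? c) λ x≁c →
        ¬commonNbr (a , b , c , a-att , b-att , a≢b , c∈ , x≁c , a~c , b~c))
      (λ {v} v∈U′ x≁v y~v → ¬d′ (v , v∈U′ , x≁v , y~v))
      attached₀)

  -- Induction on the number of vertices

  singleton-oddBlockGraph : ∀ {U v} → v ∈ U → (∀ {z} → z ∈ U → z ≡ v) → OddBlockGraph U
  singleton-oddBlockGraph v∈U only = record
    { nearMatched = λ u∈U → done λ z z∈ → ∈∖⇒≢ z∈ (trans (only (∈∖⇒∈ z∈)) (sym (only u∈U)))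
    ; separating  = λ u∈U u~a _ _ _ r → ~⇒≢ u~a (trans (only u∈U) (sym (only (∈∖⇒∈ (Reach-∈ˡ r)))))
    ; oddCliques  = λ p∈U q∈U p~q → ⊥-elim (~⇒≢ p~q (trans (only p∈U) (sym (only q∈U))))
    }

  -- Peeling an edge keeps the set connected. A tiling of the rest is completed by that edge;
  -- otherwise the edge is put back into an odd block graph.
  tiled⊎oddBlockGraph : ClawFree G → ∀ k {U} → ∣ U ∣ ≤ k → ConnectedOn G U → Tiled U ⊎ OddBlockGraph U
  tiled⊎oddBlockGraph clawFree k ∣U∣≤k connU with peel clawFree connU
  ... | inj₁ (v , v∈U , only) = inj₂ (singleton-oddBlockGraph v∈U only)
  ... | inj₂ (inj₁ (x , y , x∈U , y∈U , x~y , only)) = inj₁ (edge x∈U y∈U x~y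
    (matched (done λ z z∈ → [ ∈∖⇒≢ (∈∖⇒∈ z∈) , ∈∖⇒≢ z∈ ]′ (only (∈∖⇒∈ (∈∖⇒∈ z∈))))))
  tiled⊎oddBlockGraph clawFree zero ∣U∣≤0 connU | inj₂ (inj₂ (x , y , x∈U , y∈U , x~y , connU′)) =
    case subst (_≤ 0) (∣∖∣ x∈U) ∣U∣≤0 of λ ()
  tiled⊎oddBlockGraph clawFree (suc k) ∣U∣≤k connU | inj₂ (inj₂ (x , y , x∈U , y∈U , x~y , connU′))
    with tiled⊎oddBlockGraph clawFree k
      (ℕ.≤-trans (ℕ.n≤1+n _) (ℕ.≤-pred (subst (_≤ suc k) (∣∖∖∣₂ x∈U y∈U (~⇒≢ (~-sym x~y))) ∣U∣≤k))) connU′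
  ... | inj₁ tiled = inj₁ (edge x∈U y∈U x~y tiled)
  ... | inj₂ rest  = tiled⊎extended x∈U y∈U x~y connU (proj₁ connU′) rest

  -- From tilings to induced path decompositions

  Decomposition : Subset n → List (List (Fin n)) → Set
  Decomposition U ps = All (λ p → IsInducedPath G p × 2 ≤ length p) ps × Unique (concat ps) ×
                       (∀ {v} → v ∈ U ⇔ v ∈ₗ concat ps)

  edge-induced : ∀ {x y} → x ~ y → IsInducedPath G (x ∷ y ∷ [])
  edge-induced {x} {y} x~y = ((~⇒≢ x~y ∷ []) ∷ [] ∷ []) , λ
    { 0F 0F → mk⇔ (λ e → ⊥-elim (~⇒≢ e refl)) λ { (inj₁ ()) ; (inj₂ ()) }
    ; 0F 1F → mk⇔ (λ _ → inj₁ refl) (λ _ → x~y)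
    ; 1F 0F → mk⇔ (λ _ → inj₂ refl) (λ _ → ~-sym x~y)
    ; 1F 1F → mk⇔ (λ e → ⊥-elim (~⇒≢ e refl)) λ { (inj₁ ()) ; (inj₂ ()) }
    }

  path₃-induced : ∀ {x y z} → x ~ y → y ~ z → x ≢ z → ¬ x ~ z → IsInducedPath G (x ∷ y ∷ z ∷ [])
  path₃-induced {x} {y} {z} x~y y~z x≢z x≁z = ((~⇒≢ x~y ∷ x≢z ∷ []) ∷ (~⇒≢ y~z ∷ []) ∷ [] ∷ []) , λ
    { 0F 0F → mk⇔ (λ e → ⊥-elim (~⇒≢ e refl)) λ { (inj₁ ()) ; (inj₂ ()) }
    ; 0F 1F → mk⇔ (λ _ → inj₁ refl) (λ _ → x~y)
    ; 0F 2F → mk⇔ (λ e → ⊥-elim (x≁z e)) λ { (inj₁ ()) ; (inj₂ ()) }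
    ; 1F 0F → mk⇔ (λ _ → inj₂ refl) (λ _ → ~-sym x~y)
    ; 1F 1F → mk⇔ (λ e → ⊥-elim (~⇒≢ e refl)) λ { (inj₁ ()) ; (inj₂ ()) }
    ; 1F 2F → mk⇔ (λ _ → inj₁ refl) (λ _ → y~z)
    ; 2F 0F → mk⇔ (λ e → ⊥-elim (x≁z (~-sym e))) λ { (inj₁ ()) ; (inj₂ ()) }
    ; 2F 1F → mk⇔ (λ _ → inj₂ refl) (λ _ → ~-sym y~z)
    ; 2F 2F → mk⇔ (λ e → ⊥-elim (~⇒≢ e refl)) λ { (inj₁ ()) ; (inj₂ ()) }
    }

  -- The equivalence in `Decomposition` confines the earlier paths to `U ∖∖ p`, which makes them
  -- disjoint from `p`.
  addPath : ∀ {U p ps} → All (_∈ U) p → IsInducedPath G p → 2 ≤ length p → Decomposition (U ∖∖ p) ps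
      → Decomposition U (p ∷ ps)
  addPath {U} {p} {ps} p⊆U path 2≤ (paths , unique , covers) =
    ((path , 2≤) ∷ paths) ,
    Unique.++⁺ (proj₁ path) unique (λ (v∈p , v∈ps) → All.lookup (proj₂ (∈∖∖⁻ p (Equivalence.from covers v∈ps))) v∈p refl) ,
    mk⇔ to from
    where
    to : ∀ {v} → v ∈ U → v ∈ₗ p ++ concat ps
    to {v} v∈U with v ∈ₗ? p
    ... | yes v∈p = ∈-++⁺ˡ v∈p
    ... | no v∉p  = ∈-++⁺ʳ p (Equivalence.to covers (∈∖∖⁺ v∈U (All.tabulate λ z∈p → λ { refl → v∉p z∈p })))
    from : ∀ {v} → v ∈ₗ p ++ concat ps → v ∈ U
    from v∈ = [ All.lookup p⊆U , (λ v∈ps → proj₁ (∈∖∖⁻ p (Equivalence.from covers v∈ps))) ]′ (∈-++⁻ p v∈)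

  matched⇒tiling : ∀ {U} → Matched U → ∃ (Decomposition U)
  matched⇒tiling (done ∉U) = [] , [] , [] , mk⇔ (λ v∈U → ⊥-elim (∉U _ v∈U)) λ ()
  matched⇒tiling (pair x∈U y∈U x~y M) with matched⇒tiling M
  ... | ps , d = _ , addPath (x∈U ∷ y∈U ∷ []) (edge-induced x~y) (s≤s (s≤s z≤n)) d

  tiled⇒tiling : ∀ {U} → Tiled U → ∃ (Decomposition U)
  tiled⇒tiling (matched M) = matched⇒tiling M
  tiled⇒tiling (edge x∈U y∈U x~y t) with tiled⇒tiling t
  ... | ps , d = _ , addPath (x∈U ∷ y∈U ∷ []) (edge-induced x~y) (s≤s (s≤s z≤n)) d
  tiled⇒tiling (path₃ x∈U y∈U z∈U x~y y~z x≢z x≁z t) with tiled⇒tiling t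
  ... | ps , d = _ , addPath (x∈U ∷ y∈U ∷ z∈U ∷ []) (path₃-induced x~y y~z x≢z x≁z) (s≤s (s≤s z≤n)) d

  -- An odd block graph on all vertices would force the given block to be complete of odd order, so
  -- the induction must end in a tiling.
  block⇒IPD : Connected G → ClawFree G → (∃ λ S → IsBlock G S × ¬ OddComplete G S) → HasIPD G
  block⇒IPD conn clawFree (S , block , ¬odd) with tiled⊎oddBlockGraph clawFree _ ℕ.≤-refl conn
  ... | inj₁ tiled with tiled⇒tiling tiled
  ...   | ps , paths , unique , covers = ps , paths , unique , λ v → Equivalence.to covers ∈⊤
  block⇒IPD conn clawFree (S , block , ¬odd) | inj₂ obg =
    ⊥-elim (¬odd (block-oddComplete (OddBlockGraph.separating obg) (OddBlockGraph.oddCliques obg) block))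

theorem2 : (G : Graph) → Connected G → ClawFree G →
    (HasIPD G ⇔ (∃ λ S → IsBlock G S × ¬ OddComplete G S))
theorem2 G conn clawFree = mk⇔ (λ ipd → IPD⇒block G ipd conn) (block⇒IPD G conn clawFree)
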